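{- Let $G$ be a connected graph with $n(G)\ge 5$ vertices and clique number $\omega(G)\le n(G)-3$. Then $\dim_l(G)\le n(G)-3$. Moreover, equality $\dim_l(G)=n(G)-3$ holds if and only if $G$ is isomorphic to the cycle $C_5$ or to $K_{n(G)}^{ - }(\lambda,\mu)$ for some integers $\lambda\ge\mu\ge 2$ with $\lambda+\mu<n(G)$.
   Context: All graphs are finite and simple. $n(G)$ is the number of vertices and $\omega(G)$ the clique number of $G$. For vertices $x,y$ of a connected graph $G$, $d_G(x,y)$ is the length of a shortest $x,y$-path. A vertex $w$ distinguishes vertices $u,v$ if $d_G(u,w)\neq d_G(v,w)$. A set $W\subseteq V(G)$ is a local resolving set of $G$ if for every pair of adjacent vertices $u,v\in V(G)\setminus W$ some vertex of $W$ distinguishes $u$ and $v$. The local metric dimension $\dim_l(G)$ is the minimum cardinality of a local resolving set of $G$. For $n\ge 3$ and $1\le\mu\le\lambda$ with $\lambda+\mu\le n-1$, $K_n^{ - }(\lambda,\mu)$ denotes the graph obtained from $K_n$ by deleting all edges of a subgraph isomorphic to $K_{\lambda,\mu}$ (well defined up to isomorphism). -}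

module Defs where

open import Data.Fin using (Fin; toℕ)
open import Data.Fin.Properties as Fin using (any?; all?)
open import Data.Fin.Subset using (Subset; _∈_; _∉_; ∣_∣; ⊤; ⊥)
open import Data.Fin.Subset.Properties using (_∈?_; anySubset?; ∣p∣≤n; ∈⊤; ∉⊥)
open import Data.List using (List; []; _∷_)
open import Data.List.Relation.Unary.Unique.Propositional using (Unique)
open import Data.List.Relation.Unary.Unique.DecPropositional using (unique?)
open import Data.Nat using (ℕ; zero; suc; _+_; _≤_; _<_; z≤n; s≤s; _≟_; _≤?_; _<?_; _%_)
open import Data.Nat.Properties using (m≤n⇒m<n∨m≡n; m<1+n⇒m≤n)
open import Data.Product using (Σ; ∃; _×_; _,_; proj₁; proj₂)
open import Data.Sum using (_⊎_; inj₁; inj₂)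
import Data.Sum as Sum
open import Function using (_∘_; _⇔_; _↔_; Inverse)
open import Relation.Binary using (Symmetric; Irreflexive; Decidable)
open import Relation.Binary.PropositionalEquality using (_≡_; _≢_; refl; sym)
open import Relation.Nullary using (Dec; yes; no; ¬_; contradiction)
open import Relation.Nullary.Decidable using (map′; ¬?; _×-dec_; _⊎-dec_; _→-dec_; from-yes)
open import Relation.Unary using () renaming (Decidable to Decidable₁)

IsLeast : (ℕ → Set) → ℕ → Set
IsLeast P m = P m × (∀ k → P k → m ≤ k)

IsGreatest : (ℕ → Set) → ℕ → Set
IsGreatest P m = P m × (∀ k → P k → k ≤ m)

least : ∀ {P : ℕ → Set} → Decidable₁ P → ∀ n → P n → ∃ (IsLeast P)
least P? zero    p = zero , p , λ _ _ → z≤n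
least P? (suc n) p with P? zero
... | yes p₀ = zero , p₀ , λ _ _ → z≤n
... | no ¬p₀ with least (P? ∘ suc) n p
...   | m , q , min = suc m , q , λ where
        zero    p₀ → contradiction p₀ ¬p₀
        (suc k) pk → s≤s (min k pk)

greatest : ∀ {P : ℕ → Set} → Decidable₁ P → ∃ P →
           ∀ b → (∀ k → P k → k ≤ b) → ∃ (IsGreatest P)
greatest P? e b bound with P? b
... | yes p = b , p , bound
greatest P? (k , p) zero bound | no ¬p with bound k p
... | z≤n = contradiction p ¬p
greatest {P} P? e (suc b) bound | no ¬p = greatest P? e b bound′
  where
  bound′ : ∀ k → P k → k ≤ b
  bound′ k pk with m≤n⇒m<n∨m≡n (bound k pk)
  ... | inj₁ k<1+b = m<1+n⇒m≤n k<1+b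
  ... | inj₂ refl  = contradiction pk ¬p

record Graph (n : ℕ) : Set₁ where
  field
    Adj      : Fin n → Fin n → Set
    adj?     : Decidable Adj
    adj-sym  : Symmetric Adj
    adj-irr  : Irreflexive _≡_ Adj

open Graph public

record _≅_ {m n : ℕ} (G : Graph m) (H : Graph n) : Set where
  field
    bijection : Fin m ↔ Fin n
    adjacency : ∀ u v → Adj G u v ⇔ Adj H (Inverse.to bijection u) (Inverse.to bijection v)

infix 4 _≅_

module _ {n : ℕ} (G : Graph n) where

  IsClique : Subset n → Set
  IsClique S = ∀ u v → u ∈ S → v ∈ S → u ≢ v → Adj G u v

  data Walk : Fin n → Fin n → Set where
    stop : ∀ {u} → Walk u u
    step : ∀ {u w v} → Adj G u w → Walk w v → Walk u v

  length : ∀ {u v} → Walk u v → ℕ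
  length stop       = 0
  length (step _ p) = suc (length p)

  vertices : ∀ {u v} → Walk u v → List (Fin n)
  vertices {u} stop       = u ∷ []
  vertices {u} (step _ p) = u ∷ vertices p

  IsPath : ∀ {u v} → Walk u v → Set
  IsPath p = Unique (vertices p)

  Path : Fin n → Fin n → Set
  Path u v = Σ (Walk u v) IsPath

  Connected : Set
  Connected = ∀ u v → Path u v

  HasPathOfLength : Fin n → Fin n → ℕ → Set
  HasPathOfLength u v k = ∃ λ (p : Walk u v) → IsPath p × length p ≡ k

  HasCliqueOfSize : ℕ → Set
  HasCliqueOfSize k = ∃ λ S → IsClique S × ∣ S ∣ ≡ k

  walk? : ∀ {P : List (Fin n) → Set} → Decidable₁ P → ∀ u v k →
          Dec (∃ λ (p : Walk u v) → P (vertices p) × length p ≡ k)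
  walk? P? u v zero with u Fin.≟ v
  ... | no u≢v = no λ { (stop , _) → u≢v refl ; (step _ _ , _ , ()) }
  ... | yes refl with P? (u ∷ [])
  ...   | yes p = yes (stop , p , refl)
  ...   | no ¬p = no λ { (stop , p , _) → ¬p p ; (step _ _ , _ , ()) }
  walk? P? u v (suc k) = map′
    (λ { (w , a , p , q , refl) → step a p , q , refl })
    (λ { (step a p , q , refl) → _ , a , p , q , refl })
    (any? λ w → adj? G u w ×-dec walk? (P? ∘ (u ∷_)) w v k)

  hasPathOfLength? : ∀ u v → Decidable₁ (HasPathOfLength u v)
  hasPathOfLength? = walk? (unique? Fin._≟_)

  hasCliqueOfSize? : Decidable₁ HasCliqueOfSize
  hasCliqueOfSize? k = anySubset? λ S →
    (all? λ u → all? λ v →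
      u ∈? S →-dec v ∈? S →-dec ¬? (u Fin.≟ v) →-dec adj? G u v)
    ×-dec ∣ S ∣ ≟ k

  cliqueNumber : ∃ (IsGreatest HasCliqueOfSize)
  cliqueNumber = greatest hasCliqueOfSize?
    (_ , ⊥ , (λ u v u∈⊥ → contradiction u∈⊥ ∉⊥) , refl)
    n λ { _ (S , _ , refl) → ∣p∣≤n S }

  ω : ℕ
  ω = proj₁ cliqueNumber

module _ {n : ℕ} (G : Graph n) (conn : Connected G) where

  shortestPathLength : ∀ u v → ∃ (IsLeast (HasPathOfLength G u v))
  shortestPathLength u v =
    least (hasPathOfLength? G u v) _ (proj₁ (conn u v) , proj₂ (conn u v) , refl)

  dist : Fin n → Fin n → ℕ
  dist u v = proj₁ (shortestPathLength u v)

  Distinguishes : Fin n → Fin n → Fin n → Set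
  Distinguishes w u v = dist u w ≢ dist v w

  IsLocalResolving : Subset n → Set
  IsLocalResolving W = ∀ u v → u ∉ W → v ∉ W → Adj G u v →
                       ∃ λ w → w ∈ W × Distinguishes w u v

  HasLocalResolvingOfSize : ℕ → Set
  HasLocalResolvingOfSize k = ∃ λ W → IsLocalResolving W × ∣ W ∣ ≡ k

  hasLocalResolvingOfSize? : Decidable₁ HasLocalResolvingOfSize
  hasLocalResolvingOfSize? k = anySubset? λ W →
    (all? λ u → all? λ v →
      ¬? (u ∈? W) →-dec ¬? (v ∈? W) →-dec adj? G u v →-dec
      any? λ w → w ∈? W ×-dec ¬? (dist u w ≟ dist v w))
    ×-dec ∣ W ∣ ≟ k

  localMetricDimension : ∃ (IsLeast HasLocalResolvingOfSize)
  localMetricDimension = least hasLocalResolvingOfSize?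
    _ (⊤ , (λ u v u∉⊤ → contradiction ∈⊤ u∉⊤) , refl)

  dimₗ : ℕ
  dimₗ = proj₁ localMetricDimension

C₅ : Graph 5
C₅ = record
  { Adj     = λ i j → Next i j ⊎ Next j i
  ; adj?    = next⊎?
  ; adj-sym = Sum.swap
  ; adj-irr = λ { {i} refl → from-yes (all? λ i → ¬? (next⊎? i i)) i }
  }
  where
  Next : Fin 5 → Fin 5 → Set
  Next i j = suc (toℕ i) % 5 ≡ toℕ j

  next⊎? : Decidable λ i j → Next i j ⊎ Next j i
  next⊎? i j = (suc (toℕ i) % 5 ≟ toℕ j) ⊎-dec (suc (toℕ j) % 5 ≟ toℕ i)

-- The deleted copy of K_{l,m} has parts {0,…,l-1} and {l,…,l+m-1}; this is
-- K_n^-(l,m) only when l + m ≤ n, since otherwise the second part is truncated.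
K⁻ : (n l m : ℕ) → Graph n
K⁻ n l m = record
  { Adj     = λ u v → u ≢ v × ¬ (Deleted u v ⊎ Deleted v u)
  ; adj?    = λ u v → ¬? (u Fin.≟ v) ×-dec ¬? (deleted? u v ⊎-dec deleted? v u)
  ; adj-sym = λ { (u≢v , ¬d) → u≢v ∘ sym , ¬d ∘ Sum.swap }
  ; adj-irr = λ { u≡v (u≢v , _) → u≢v u≡v }
  }
  where
  InLeft InRight : Fin n → Set
  InLeft  u = toℕ u < l
  InRight u = l ≤ toℕ u × toℕ u < l + m

  Deleted : Fin n → Fin n → Set
  Deleted u v = InLeft u × InRight v

  deleted? : Decidable Deleted
  deleted? u v = (toℕ u <? l) ×-dec ((l ≤? toℕ v) ×-dec (toℕ v <? l + m))

{-# OPTIONS --safe #-}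

-- Write U for the complement of a local resolving set; the question is how large a "spread" U can
-- be, i.e. one in which every adjacent pair is separated by a vertex outside U. Assume that no
-- spread set has four vertices.
--
-- If some vertex lies at distance three from r, then r separates the distance levels from r, so
-- every level is a clique that cannot be split by a vertex outside it, and ω(G) ≤ n - 3 forces the
-- levels to be large enough for a spread set of four vertices. Hence G has diameter two.
--
-- Suppose next that some vertex x has a nonneighbour y and two nonadjacent neighbours a and b. As
-- ω(G) ≤ n - 3, the complement of G has no vertex cover of size two, and for n ≥ 6 this already
-- holds on six vertices including x, y, a, b. A finite search shows that these six vertices,
-- together with a common neighbour of a suitable nonadjacent pair, contain a spread set of four
-- vertices. So n = 5, and G is the pentagon.
--
-- Otherwise every vertex is universal or has a clique as neighbourhood. The non-universal vertices
-- then form disjoint cliques, and a third clique would give a spread set of four vertices, so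
-- G = K⁻(λ,μ). Conversely, in K⁻(λ,μ) two vertices of the same block are twins, so at most one
-- vertex of each of the three blocks can be left out of a local resolving set.

module Submission where

open import Defs
open import Data.Bool using (Bool; true; false; not; _∧_; T; T?)
open import Data.Bool.Properties as Bool using (T-∧)
open import Data.Empty using (⊥; ⊥-elim)
open import Data.Fin using (Fin; zero; suc; toℕ; _↑ˡ_; _↑ʳ_)
open import Data.Fin.Patterns using (0F; 1F; 2F; 3F; 4F; 5F)
open import Data.Fin.Permutation using (↔⇒≡)
open import Data.Fin.Properties as Fin
  using (_≟_; any?; all?; injective⇒≤; ¬∀⟶∃¬; toℕ<n; toℕ-↑ˡ; toℕ-↑ʳ; +↔⊎)
open import Data.Fin.Subset as Subset using (Subset; inside; outside; ∣_∣; ∁; ⁅_⁆; _∪_; _-_)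
open import Data.Fin.Subset.Properties as Subset
  using (∣⊤∣≡n; ∈⊤; ∣∁p∣≡n∸∣p∣; x∈∁p⇒x∉p; x∈p∪q⁻; x∈p∪q⁺; x∈⁅x⁆; x∈⁅y⁆⇒x≡y;
         x∈p∧x≢y⇒x∈p-y; x∈p⇒∣p-x∣<∣p∣)
open import Data.List as List using (List; []; _∷_)
open import Data.List.Membership.Propositional using (_∈_; _∉_)
open import Data.List.Membership.Propositional.Properties using (∈-lookup; ∈-map⁻)
open import Data.List.Membership.Setoid.Properties using (index-injective)
open import Data.List.Properties using (length-map)
open import Data.List.Relation.Binary.Permutation.Propositional
  using (_↭_; prep; swap; ↭-refl; ↭-sym; ↭⇒↭ₛ)
open import Data.List.Relation.Binary.Permutation.Propositional.Properties using (∈-resp-↭)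
open import Data.List.Relation.Binary.Permutation.Setoid.Properties using (Unique-resp-↭)
open import Data.List.Relation.Unary.All as All using (All; []; _∷_)
open import Data.List.Relation.Unary.All.Properties using (¬Any⇒All¬; All¬⇒¬Any)
open import Data.List.Relation.Unary.AllPairs as AllPairs using (AllPairs; []; _∷_; allPairs?)
import Data.List.Relation.Unary.AllPairs.Properties as AllPairs
open import Data.List.Relation.Unary.Any as Any using (Any; here; there; index)
open import Data.List.Relation.Unary.Any.Properties using (lookup-index)
open import Data.List.Relation.Unary.Unique.Propositional using (Unique)
open import Data.Nat as ℕ using (ℕ; zero; suc; _+_; _∸_; _≤_; _<_; z≤n; s≤s; _≤?_; _<?_)
open import Data.Nat.Properties as ℕ
  using (≤-refl; ≤-reflexive; ≤-trans; ≤-antisym; ≤-pred; ≤-total; ≰⇒>; ≮⇒≥; <⇒≤; <⇒≱; <⇒≢;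
         n≤1+n; n≤0⇒n≡0; m≤n⇒m≤1+n; m≤n⇒∃[o]m+o≡n; m≤m+n; m<m+n; +-suc; +-comm; +-identityʳ;
         +-monoˡ-≤; +-monoʳ-≤; +-monoʳ-<; ∸-monoʳ-≤; ∸-monoʳ-<; m≤n+m∸n; m≤n+o⇒m∸n≤o;
         m+n≤o⇒m≤o∸n; module ≤-Reasoning)
open import Data.Product using (∃; ∃₂; Σ; _×_; _,_; proj₁; proj₂)
open import Data.Sum as Sum using (_⊎_; inj₁; inj₂; [_,_]′)
open import Data.Sum.Function.Propositional using (_⊎-↔_)
open import Data.Unit using (⊤; tt)
open import Data.Vec as Vec using (Vec; []; _∷_; tabulate)
open import Data.Vec.Properties using (lookup∘tabulate)
open import Function using (_∘_; _⇔_; _↔_; mk⇔; mk↔ₛ′; Equivalence; Inverse)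
open import Function.Construct.Composition using (_↔-∘_)
open import Function.Construct.Identity using (↔-id)
open import Function.Construct.Symmetry using (↔-sym)
open import Function.Related.TypeIsomorphisms using (⊎-comm)
open import Relation.Binary.PropositionalEquality
  using (_≡_; _≢_; refl; sym; trans; cong; subst; subst₂; ≢-sym; setoid)
open import Relation.Nullary using (¬_; Dec; does; yes; no; contradiction)
open import Relation.Nullary.Decidable
  using (map′; ¬?; _×-dec_; _⊎-dec_; _→-dec_; decidable-stable; from-yes; dec-true; dec-false)
open import Relation.Unary using () renaming (Decidable to Decidable₁)

private variable
  n k l m r : ℕ
  E : Set
  e e₁ e₂ e₃ e₄ : E
  es : List E

-- Distances and separation

_∈?_ : (x : Fin n) (xs : List (Fin n)) → Dec (x ∈ xs)
x ∈? xs = Any.any? (x ≟_) xs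

elementAt : (S : Subset n) → Fin ∣ S ∣ → Fin n
elementAt (inside  ∷ S) zero    = zero
elementAt (inside  ∷ S) (suc i) = suc (elementAt S i)
elementAt (outside ∷ S) i       = suc (elementAt S i)

elementAt-∈ : (S : Subset n) (i : Fin ∣ S ∣) → elementAt S i Subset.∈ S
elementAt-∈ (inside  ∷ S) zero    = Vec.here
elementAt-∈ (inside  ∷ S) (suc i) = Vec.there (elementAt-∈ S i)
elementAt-∈ (outside ∷ S) i       = Vec.there (elementAt-∈ S i)

elementAt-injective : (S : Subset n) {i j : Fin ∣ S ∣} →
                      elementAt S i ≡ elementAt S j → i ≡ j
elementAt-injective (inside  ∷ S) {zero}  {zero}  _  = refl
elementAt-injective (inside  ∷ S) {suc i} {suc j} eq =
  cong suc (elementAt-injective S (Fin.suc-injective eq))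
elementAt-injective (outside ∷ S) eq = elementAt-injective S (Fin.suc-injective eq)

injectiveOn⇒∣S∣≤ : (S : Subset n) (f : Fin n → Fin k) →
                   (∀ {u v} → u Subset.∈ S → v Subset.∈ S → f u ≡ f v → u ≡ v) → ∣ S ∣ ≤ k
injectiveOn⇒∣S∣≤ S f inj = injective⇒≤ {f = f ∘ elementAt S} λ eq →
  elementAt-injective S (inj (elementAt-∈ S _) (elementAt-∈ S _) eq)

lookup-injective : {A : Set} {xs : List A} → Unique xs →
                   ∀ {i j} → List.lookup xs i ≡ List.lookup xs j → i ≡ j
lookup-injective (_    ∷ _) {zero}  {zero}  _  = refl
lookup-injective (x≢xs ∷ _) {zero}  {suc j} eq = contradiction eq (All.lookup x≢xs (∈-lookup j))
lookup-injective (x≢xs ∷ _) {suc i} {zero}  eq = contradiction (sym eq) (All.lookup x≢xs (∈-lookup i))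
lookup-injective (_    ∷ u) {suc i} {suc j} eq = cong suc (lookup-injective u eq)

unique⇒length≤ : {xs : List (Fin n)} → Unique xs → List.length xs ≤ n
unique⇒length≤ u = injective⇒≤ (lookup-injective u)

-- If every vertex were listed, sending each to its index would inject `Fin n` into a smaller finite
-- type.
fresh : (xs : List (Fin n)) → List.length xs < n → ∃ (_∉ xs)
fresh xs l = ¬∀⟶∃¬ _ (_∈ xs) (_∈? xs) λ all →
  <⇒≱ l (injective⇒≤ {f = index ∘ all} λ eq → index-injective (setoid _) (all _) (all _) eq)

-- `AllPairs` relates an earlier entry to a later one only, hence the two alternatives.
allPairs-lookup : {A : Set} {R : A → A → Set} {xs : List A} → AllPairs R xs →
                  ∀ {x y} → x ∈ xs → y ∈ xs → x ≢ y → R x y ⊎ R y x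
allPairs-lookup (_ ∷ _)  (here refl) (here refl) x≢y = contradiction refl x≢y
allPairs-lookup (r ∷ _)  (here refl) (there y∈)  _   = inj₁ (All.lookup r y∈)
allPairs-lookup (r ∷ _)  (there x∈)  (here refl) _   = inj₂ (All.lookup r x∈)
allPairs-lookup (_ ∷ rs) (there x∈)  (there y∈)  x≢y = allPairs-lookup rs x∈ y∈ x≢y

infix 6 ∁[_]

∁[_] : List (Fin n) → Subset n
∁[ xs ] = List.foldr (λ x S → S - x) Subset.⊤ xs

∉⇒∈∁ : (xs : List (Fin n)) → ∀ {x} → x ∉ xs → x Subset.∈ ∁[ xs ]
∉⇒∈∁ []       _    = ∈⊤
∉⇒∈∁ (y ∷ xs) x∉xs = x∈p∧x≢y⇒x∈p-y (∉⇒∈∁ xs (x∉xs ∘ there)) (x∉xs ∘ here)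

∉∁⇒∈ : (xs : List (Fin n)) → ∀ {x} → x Subset.∉ ∁[ xs ] → x ∈ xs
∉∁⇒∈ xs x∉ = decidable-stable (_ ∈? xs) (x∉ ∘ ∉⇒∈∁ xs)

∣∁∣+length≤ : {xs : List (Fin n)} → Unique xs → ∣ ∁[ xs ] ∣ + List.length xs ≤ n
∣∁∣+length≤ {n} []             = ≤-reflexive (trans (+-identityʳ _) (∣⊤∣≡n n))
∣∁∣+length≤ {xs = x ∷ xs} (x≢ ∷ u) = ≤-trans (≤-reflexive (+-suc _ _)) (≤-trans
  (+-monoˡ-≤ (List.length xs) (x∈p⇒∣p-x∣<∣p∣ (∉⇒∈∁ xs (All¬⇒¬Any x≢)))) (∣∁∣+length≤ u))

module _ (G : Graph n) where

  suffix : ∀ {u v w} (p : Walk G u v) → IsPath G p → w ∈ vertices G p →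
           ∃ λ (q : Walk G w v) → IsPath G q × length G q ≤ length G p
  suffix stop       path       (here refl) = stop , path , ≤-refl
  suffix (step a p) path       (here refl) = step a p , path , ≤-refl
  suffix (step a p) (_ ∷ path) (there w∈p) with suffix p path w∈p
  ... | q , path′ , le = q , path′ , m≤n⇒m≤1+n le

  -- Loop erasure: if the start recurs further on, the walk is cut at that occurrence. Distances are
  -- defined by paths, and this lets any walk bound them.
  toPath : ∀ {u v} (p : Walk G u v) →
           ∃ λ (q : Walk G u v) → IsPath G q × length G q ≤ length G p
  toPath stop = stop , [] ∷ [] , ≤-refl
  toPath (step {u} a p) with toPath p
  ... | q , path , le with u ∈? vertices G q
  ...   | no u∉q  = step a q , ¬Any⇒All¬ _ u∉q ∷ path , s≤s le
  ...   | yes u∈q with suffix q path u∈q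
  ...     | r , path′ , le′ = r , path′ , ≤-trans le′ (m≤n⇒m≤1+n le)

  snoc : ∀ {u v w} (p : Walk G u v) → Adj G v w →
         ∃ λ (q : Walk G u w) → length G q ≡ suc (length G p)
  snoc stop       b = step b stop , refl
  snoc (step a p) b with snoc p b
  ... | q , eq = step a q , cong suc eq

  reverse : ∀ {u v} (p : Walk G u v) → ∃ λ (q : Walk G v u) → length G q ≡ length G p
  reverse stop       = stop , refl
  reverse (step a p) with reverse p
  ... | q , eq with snoc q (adj-sym G a)
  ...   | r , eq′ = r , trans eq′ (cong suc eq)

module Metric (G : Graph n) (conn : Connected G) where

  adj⇒≢ : ∀ {u v} → Adj G u v → u ≢ v
  adj⇒≢ uv refl = adj-irr G refl uv

  -- Opaque because `dist` unfolds to a search through all walks.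
  opaque
    d : Fin n → Fin n → ℕ
    d = dist G conn

    d≡dist : ∀ u v → d u v ≡ dist G conn u v
    d≡dist u v = refl

    dist≤length : ∀ {u v} (p : Walk G u v) → d u v ≤ length G p
    dist≤length {u} {v} p with toPath G p
    ... | q , path , le =
      ≤-trans (proj₂ (proj₂ (shortestPathLength G conn u v)) _ (q , path , refl)) le

    geodesic : ∀ u v → ∃ λ (p : Walk G u v) → length G p ≡ d u v
    geodesic u v with proj₁ (proj₂ (shortestPathLength G conn u v))
    ... | p , _ , eq = p , eq

  dist-step : ∀ {u w v} → Adj G u w → d u v ≤ suc (d w v)
  dist-step {w = w} {v} a with geodesic w v
  ... | p , eq = ≤-trans (dist≤length (step a p)) (≤-reflexive (cong suc eq))

  -- First step of a geodesic: the remaining walk has length `k`, and a smaller distance from `w`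
  -- would contradict `dist-step`.
  dist-pred : ∀ {u v k} → d u v ≡ suc k → ∃ λ w → Adj G u w × d w v ≡ k
  dist-pred {u} {v} eq with geodesic u v
  ... | stop     , eq′ = contradiction (trans eq′ eq) λ ()
  ... | step a p , eq′ with trans eq′ eq
  ...   | refl = _ , a , ≤-antisym (dist≤length p)
                           (≤-pred (≤-trans (≤-reflexive (sym eq)) (dist-step a)))

  dist-sym : ∀ u v → d u v ≡ d v u
  dist-sym u v = ≤-antisym (half u v) (half v u)
    where
    half : ∀ u v → d u v ≤ d v u
    half u v with geodesic v u
    ... | p , eq with reverse G p
    ...   | q , eq′ = ≤-trans (dist≤length q) (≤-reflexive (trans eq′ eq))

  dist-refl : ∀ u → d u u ≡ 0
  dist-refl u = n≤0⇒n≡0 (dist≤length stop)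

  dist≡0⇒≡ : ∀ {u v} → d u v ≡ 0 → u ≡ v
  dist≡0⇒≡ {u} {v} eq with geodesic u v
  ... | stop     , _   = refl
  ... | step _ _ , eq′ = contradiction (trans eq′ eq) λ ()

  dist≡1⇒adj : ∀ {u v} → d u v ≡ 1 → Adj G u v
  dist≡1⇒adj eq with dist-pred eq
  ... | _ , a , eq′ with dist≡0⇒≡ eq′
  ...   | refl = a

  adj⇒dist≡1 : ∀ {u v} → Adj G u v → d u v ≡ 1
  adj⇒dist≡1 {u} {v} a with d u v in eq | dist≤length (step a stop)
  ... | zero        | _ = contradiction (dist≡0⇒≡ eq) λ u≡v → adj-irr G u≡v a
  ... | suc zero    | _ = refl
  ... | suc (suc _) | s≤s ()

  -- Adjacency means distance one, so adjacency alone can certify a separation. This is what allows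
  -- the later search to work with adjacency matrices.
  adj-differs : ∀ {u v w} → Adj G u w → ¬ Adj G v w → d u w ≢ d v w
  adj-differs a ¬b eq = ¬b (dist≡1⇒adj (trans (sym eq) (adj⇒dist≡1 a)))

  -- U plays the role of the complement of a local resolving set.
  Separated : List (Fin n) → Fin n → Fin n → Set
  Separated U u v = ¬ Adj G u v ⊎ ∃ λ w → w ∉ U × d u w ≢ d v w

  -- The inequality keeps the list free of repetitions, so its length counts the vertices left out
  -- of the resolving set.
  Spread : List (Fin n) → Set
  Spread U = AllPairs (λ u v → u ≢ v × Separated U u v) U

  sepˡ : ∀ {U u v w} → w ∉ U → Adj G u w → ¬ Adj G v w → Separated U u v
  sepˡ w∉U a ¬b = inj₂ (_ , w∉U , adj-differs a ¬b)

  sepʳ : ∀ {U u v w} → w ∉ U → ¬ Adj G u w → Adj G v w → Separated U u v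
  sepʳ w∉U ¬a b = inj₂ (_ , w∉U , adj-differs b ¬a ∘ sym)

  -- The complement `∁[ U ]` is locally resolving: adjacent vertices outside it lie in `U`, and the
  -- vertex separating them, being outside `U`, lies in it.
  spread⇒dim+length≤ : ∀ {U} → Spread U → dimₗ G conn + List.length U ≤ n
  spread⇒dim+length≤ {U} spread = ≤-trans
    (+-monoˡ-≤ (List.length U)
      (proj₂ (proj₂ (localMetricDimension G conn)) _ (∁[ U ] , resolving , refl)))
    (∣∁∣+length≤ (AllPairs.map proj₁ spread))
    where
    d-cong : ∀ {u v w} → dist G conn u w ≡ dist G conn v w → d u w ≡ d v w
    d-cong eq = trans (d≡dist _ _) (trans eq (sym (d≡dist _ _)))

    resolving : IsLocalResolving G conn ∁[ U ]
    resolving u v u∉ v∉ a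
      with allPairs-lookup spread (∉∁⇒∈ U u∉) (∉∁⇒∈ U v∉) (adj⇒≢ a)
    ... | inj₁ (_ , inj₁ ¬a)            = contradiction a ¬a
    ... | inj₂ (_ , inj₁ ¬a)            = contradiction (adj-sym G a) ¬a
    ... | inj₁ (_ , inj₂ (w , w∉U , ≢)) = w , ∉⇒∈∁ U w∉U , ≢ ∘ d-cong
    ... | inj₂ (_ , inj₂ (w , w∉U , ≢)) = w , ∉⇒∈∁ U w∉U , ≢ ∘ sym ∘ d-cong

-- Exhaustive search on six and seven vertices

Matrix : ℕ → Set
Matrix k = Fin k → Fin k → Bool

-- Only the entries above the diagonal are stored, so tables enumerate the labelled simple graphs,
-- each once. The row of vertex 0 comes first; prepending a row adds a new vertex 0.
Table : ℕ → Set
Table zero    = ⊤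
Table (suc k) = Vec Bool k × Table k

⟦_⟧ : Table k → Matrix k
⟦ r , t ⟧ zero    zero    = false
⟦ r , t ⟧ zero    (suc j) = Vec.lookup r j
⟦ r , t ⟧ (suc i) zero    = Vec.lookup r i
⟦ r , t ⟧ (suc i) (suc j) = ⟦ t ⟧ i j

table : Matrix k → Table k
table {zero}  M = tt
table {suc k} M = tabulate (M zero ∘ suc) , table λ i j → M (suc i) (suc j)

⟦table⟧ : (M : Matrix k) → (∀ i → M i i ≡ false) → (∀ i j → M i j ≡ M j i) →
          ∀ i j → ⟦ table M ⟧ i j ≡ M i j
⟦table⟧ M irr sy zero    zero    = sym (irr zero)
⟦table⟧ M irr sy zero    (suc j) = lookup∘tabulate _ j
⟦table⟧ M irr sy (suc i) zero    = trans (lookup∘tabulate _ i) (sy zero (suc i))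
⟦table⟧ M irr sy (suc i) (suc j) =
  ⟦table⟧ (λ i j → M (suc i) (suc j)) (irr ∘ suc) (λ i j → sy (suc i) (suc j)) i j

allVec? : ∀ {P : Vec Bool k → Set} → Decidable₁ P → Dec (∀ v → P v)
allVec? {zero}  P? = map′ (λ { p [] → p }) (λ p → p []) (P? [])
allVec? {suc k} P? = map′
  (λ { (f , t) (false ∷ v) → f v ; (f , t) (true ∷ v) → t v })
  (λ p → p ∘ (false ∷_) , p ∘ (true ∷_))
  (allVec? (P? ∘ (false ∷_)) ×-dec allVec? (P? ∘ (true ∷_)))

-- The two Boolean quantifiers keep the search below from retaining the evidence of every case.
everyVec : (Vec Bool k → Bool) → Bool
everyVec {zero}  f = f []
everyVec {suc k} f = everyVec (f ∘ (false ∷_)) ∧ everyVec (f ∘ (true ∷_))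

everyVec-sound : (f : Vec Bool k → Bool) → T (everyVec f) → ∀ v → T (f v)
everyVec-sound f h []          = h
everyVec-sound f h (false ∷ v) = everyVec-sound (f ∘ (false ∷_)) (proj₁ (Equivalence.to T-∧ h)) v
everyVec-sound f h (true  ∷ v) =
  everyVec-sound (f ∘ (true ∷_)) (proj₂ (Equivalence.to (T-∧ {everyVec (f ∘ (false ∷_))}) h)) v

everyTable : (Table k → Bool) → Bool
everyTable {zero}  f = f tt
everyTable {suc k} f = everyTable λ t → everyVec λ r → f (r , t)

everyTable-sound : (f : Table k → Bool) → T (everyTable f) → ∀ t → T (f t)
everyTable-sound {zero}  f h tt      = h
everyTable-sound {suc k} f h (r , t) = everyVec-sound _ (everyTable-sound _ h t) r

module _ (M : Matrix k) where

  -- Separation is certified by adjacency to a vertex of the table, so it remains valid in any graph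
  -- containing the table as an induced subgraph.
  SeparatedM : List (Fin k) → Fin k → Fin k → Set
  SeparatedM U u v = M u v ≡ false ⊎ ∃ λ w → M u w ≢ M v w × w ∉ U

  SpreadM : List (Fin k) → Set
  SpreadM U = AllPairs (λ u v → SeparatedM U u v × u ≢ v) U × List.length U ≡ 4

  spreadM? : Decidable₁ SpreadM
  spreadM? U = allPairs? (λ u v →
    ((M u v Bool.≟ false) ⊎-dec any? λ w → ¬? (M u w Bool.≟ M v w) ×-dec ¬? (w ∈? U)) ×-dec ¬? (u ≟ v)) U
    ×-dec List.length U ℕ.≟ 4

choose : {A : Set} → ℕ → List A → List (List A)
choose zero    xs       = [] ∷ []
choose (suc m) []       = []
choose (suc m) (x ∷ xs) = List.map (x ∷_) (choose m xs) List.++ choose (suc m) xs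

Good : Matrix k → Set
Good {k} M = Any (SpreadM M) (choose 4 (List.allFin k))

good? : (M : Matrix k) → Dec (Good M)
good? {k} M = Any.any? (spreadM? M) (choose 4 (List.allFin k))

-- A witness that `i` and `j` do not form a vertex cover of the complement graph.
Uncovered : Matrix k → Fin k → Fin k → Set
Uncovered M i j = ∃₂ λ u v → u ≢ v × M u v ≡ false × (u ∉ i ∷ j ∷ []) × (v ∉ i ∷ j ∷ [])

uncovered? : (M : Matrix k) (i j : Fin k) → Dec (Uncovered M i j)
uncovered? M i j = any? λ u → any? λ v →
  ¬? (u ≟ v) ×-dec (M u v Bool.≟ false) ×-dec ¬? (u ∈? (i ∷ j ∷ [])) ×-dec ¬? (v ∈? (i ∷ j ∷ []))

-- In a table on six vertices the vertices of the core are 2, 3, 4, 5. A set of two vertices meeting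
-- all nonadjacent pairs must contain one vertex of {2,3} and one of {4,5}, whence the four cases of
-- Thick.
Core : Matrix 4 → Set
Core M = M 2F 3F ≡ false × M 0F 1F ≡ false × M 0F 2F ≡ true × M 0F 3F ≡ true

core? : (M : Matrix 4) → Dec (Core M)
core? M = (M 2F 3F Bool.≟ false) ×-dec (M 0F 1F Bool.≟ false) ×-dec
          (M 0F 2F Bool.≟ true) ×-dec (M 0F 3F Bool.≟ true)

Thick : Matrix 6 → Set
Thick M = Uncovered M 2F 4F × Uncovered M 2F 5F × Uncovered M 3F 4F × Uncovered M 3F 5F

thick? : (M : Matrix 6) → Dec (Thick M)
thick? M = uncovered? M 2F 4F ×-dec uncovered? M 2F 5F ×-dec
           uncovered? M 3F 4F ×-dec uncovered? M 3F 5F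

-- In diameter two the nonadjacent `p` and `q` have a common neighbour, here necessarily a seventh
-- vertex. It is added as vertex 0, its other adjacencies being arbitrary.
Extensible : Table 6 → Set
Extensible t = ∃₂ λ p q → ⟦ t ⟧ p q ≡ false × p ≢ q ×
  (∀ w → ¬ (⟦ t ⟧ p w ≡ true × ⟦ t ⟧ q w ≡ true)) ×
  (∀ (r : Vec Bool 6) → Vec.lookup r p ≡ true × Vec.lookup r q ≡ true → Good ⟦ r , t ⟧)

extensible? : (t : Table 6) → Dec (Extensible t)
extensible? t = any? λ p → any? λ q → (⟦ t ⟧ p q Bool.≟ false) ×-dec ¬? (p ≟ q) ×-dec
  (all? λ w → ¬? ((⟦ t ⟧ p w Bool.≟ true) ×-dec (⟦ t ⟧ q w Bool.≟ true))) ×-dec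
  (allVec? λ r → ((Vec.lookup r p Bool.≟ true) ×-dec (Vec.lookup r q Bool.≟ true))
    →-dec good? ⟦ r , t ⟧)

T-does⁻ : {A : Set} (A? : Dec A) → T (does A?) → A
T-does⁻ (yes a) _ = a

opaque
  -- Established by evaluation over all tables. The core is tested before the rows of the two
  -- further vertices are enumerated, so that unsuitable cores are discarded early.
  thick⇒good⊎extensible : (t : Table 4) → Core ⟦ t ⟧ → (q : Vec Bool 4) (p : Vec Bool 5) →
    Thick ⟦ p , q , t ⟧ → Good ⟦ p , q , t ⟧ ⊎ Extensible (p , q , t)
  thick⇒good⊎extensible t core q p = T-does⁻ (goal? t q p) (everyVec-sound (does ∘ goal? t q)
    (everyVec-sound (everyVec ∘ λ q → does ∘ goal? t q)
      (T-does⁻ (extensions? t) (everyTable-sound (does ∘ extensions?) tt t) core) q) p)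
    where
    goal? : (t : Table 4) (q : Vec Bool 4) (p : Vec Bool 5) →
            Dec (Thick ⟦ p , q , t ⟧ → Good ⟦ p , q , t ⟧ ⊎ Extensible (p , q , t))
    goal? t q p = thick? ⟦ p , q , t ⟧ →-dec (good? ⟦ p , q , t ⟧ ⊎-dec extensible? (p , q , t))

    extensions? : (t : Table 4) → Dec (Core ⟦ t ⟧ → T (everyVec (everyVec ∘ λ q → does ∘ goal? t q)))
    extensions? t = core? ⟦ t ⟧ →-dec T? _

good-resp : {M N : Matrix k} → (∀ i j → M i j ≡ N i j) → Good M → Good N
good-resp {M = M} {N} M≗N = Any.map λ (spread , len) →
  AllPairs.map (λ { (s , u≢v) → separated s , u≢v }) spread , len
  where
  separated : ∀ {U u v} → SeparatedM M U u v → SeparatedM N U u v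
  separated (inj₁ ¬a)            = inj₁ (trans (sym (M≗N _ _)) ¬a)
  separated (inj₂ (w , ≢ , w∉U)) =
    inj₂ (w , (λ eq → ≢ (trans (M≗N _ w) (trans eq (sym (M≗N _ w))))) , w∉U)

uncovered-resp : {M N : Matrix k} → (∀ i j → M i j ≡ N i j) →
                 ∀ {i j} → Uncovered M i j → Uncovered N i j
uncovered-resp M≗N (u , v , u≢v , ¬a , u∉ , v∉) = u , v , u≢v , trans (sym (M≗N u v)) ¬a , u∉ , v∉

does-true⁻ : {A : Set} (A? : Dec A) → does A? ≡ true → A
does-true⁻ (yes a) _ = a

does-false⁻ : {A : Set} (A? : Dec A) → does A? ≡ false → ¬ A
does-false⁻ (no ¬a) _ = ¬a

module _ (G : Graph n) where

  adjMatrix : (xs : List (Fin n)) → Matrix (List.length xs)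
  adjMatrix xs i j = does (adj? G (List.lookup xs i) (List.lookup xs j))

  adjTable : (xs : List (Fin n)) → Table (List.length xs)
  adjTable xs = table (adjMatrix xs)

  ⟦adjTable⟧ : (xs : List (Fin n)) → ∀ i j → ⟦ adjTable xs ⟧ i j ≡ adjMatrix xs i j
  ⟦adjTable⟧ xs = ⟦table⟧ (adjMatrix xs)
    (λ i → dec-false (adj? G _ _) (adj-irr G refl)) λ i j → does-sym _ _
    where
    does-sym : ∀ u v → does (adj? G u v) ≡ does (adj? G v u)
    does-sym u v with adj? G v u
    ... | yes a = dec-true  (adj? G u v) (adj-sym G a)
    ... | no ¬a = dec-false (adj? G u v) (¬a ∘ adj-sym G)

  Missed : List (Fin n) → Fin n → Fin n → Set
  Missed xs p q = ∃₂ λ u v → u ∈ xs × v ∈ xs × u ≢ v × ¬ Adj G u v × (u ∉ p ∷ q ∷ []) × (v ∉ p ∷ q ∷ [])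

  missed⇒uncovered : ∀ xs {i j} → Missed xs (List.lookup xs i) (List.lookup xs j) →
                     Uncovered ⟦ adjTable xs ⟧ i j
  missed⇒uncovered xs (u , v , u∈ , v∈ , u≢v , ¬uv , u∉ , v∉) =
    uncovered-resp (λ i j → sym (⟦adjTable⟧ xs i j))
      (Any.index u∈ , Any.index v∈ ,
       (λ eq → u≢v (trans (lookup-index u∈)
         (trans (cong (List.lookup xs) eq) (sym (lookup-index v∈))))) ,
       dec-false (adj? G _ _) (subst₂ (λ u v → ¬ Adj G u v) (lookup-index u∈) (lookup-index v∈) ¬uv) ,
       index-∉ u∈ u∉ , index-∉ v∈ v∉)
    where
    index-∉ : ∀ {u i j} (u∈ : u ∈ xs) → u ∉ List.lookup xs i ∷ List.lookup xs j ∷ [] →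
              Any.index u∈ ∉ i ∷ j ∷ []
    index-∉ u∈ u∉ (here eq)         = u∉ (here (trans (lookup-index u∈) (cong (List.lookup xs) eq)))
    index-∉ u∈ u∉ (there (here eq)) = u∉ (there (here (trans (lookup-index u∈) (cong (List.lookup xs) eq))))

module _ (G : Graph n) (conn : Connected G) where

  open Metric G conn

  good⇒spread : {xs : List (Fin n)} → Unique xs → Good (adjMatrix G xs) →
                ∃ λ U → Spread U × List.length U ≡ 4
  good⇒spread {xs} unique good with Any.satisfied good
  ... | U , pairs , len = List.map at U , AllPairs.map⁺ (AllPairs.map pair pairs) ,
                          trans (length-map at U) len
    where
    at = List.lookup xs
    -- Equal distances to `w` force equal adjacency to `w`; hence a difference in the matrix is a
    -- difference of distances.
    does-dist : ∀ {u v w} → d u w ≡ d v w → does (adj? G u w) ≡ does (adj? G v w)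
    does-dist {u} {v} {w} eq with adj? G u w | adj? G v w
    ... | yes _ | yes _ = refl
    ... | no  _ | no  _ = refl
    ... | yes a | no ¬b = contradiction eq (adj-differs a ¬b)
    ... | no ¬a | yes b = contradiction (sym eq) (adj-differs b ¬a)
    at-∉ : ∀ {w} → w ∉ U → at w ∉ List.map at U
    at-∉ w∉U w∈ with ∈-map⁻ at w∈
    ... | x , x∈U , eq with lookup-injective unique eq
    ...   | refl = w∉U x∈U
    pair : ∀ {u v} → SeparatedM (adjMatrix G xs) U u v × u ≢ v →
           at u ≢ at v × Separated (List.map at U) (at u) (at v)
    pair (inj₁ ¬a , u≢v)            =
      u≢v ∘ lookup-injective unique , inj₁ (does-false⁻ (adj? G _ _) ¬a)
    pair (inj₂ (w , ≢ , w∉U) , u≢v) =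
      u≢v ∘ lookup-injective unique , inj₂ (at w , at-∉ w∉U , ≢ ∘ does-dist)

  thick⇒spread : (∀ {p q} → p ≢ q → ¬ Adj G p q → ∃ λ z → Adj G p z × Adj G q z) →
    ∀ {s t x y a b} (let xs = s ∷ t ∷ x ∷ y ∷ a ∷ b ∷ []) → Unique xs →
    ¬ Adj G x y → ¬ Adj G a b → Adj G x a → Adj G x b →
    Missed G xs x a → Missed G xs x b → Missed G xs y a → Missed G xs y b →
    ∃ λ U → Spread U × List.length U ≡ 4
  thick⇒spread common {s} {t} {x} {y} {a} {b} unique ¬xy ¬ab xa xb m₁ m₂ m₃ m₄
    with thick⇒good⊎extensible (proj₂ (proj₂ (adjTable G xs)))
           (dec-false (adj? G _ _) ¬ab , dec-false (adj? G _ _) ¬xy ,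
            dec-true (adj? G _ _) xa , dec-true (adj? G _ _) xb)
           (proj₁ (proj₂ (adjTable G xs))) (proj₁ (adjTable G xs))
           (missed⇒uncovered G xs m₁ , missed⇒uncovered G xs m₂ ,
            missed⇒uncovered G xs m₃ , missed⇒uncovered G xs m₄)
    where xs = s ∷ t ∷ x ∷ y ∷ a ∷ b ∷ []
  ... | inj₁ good = good⇒spread unique (good-resp (⟦adjTable⟧ G (s ∷ t ∷ x ∷ y ∷ a ∷ b ∷ [])) good)
  ... | inj₂ (p , q , ¬pq , p≢q , none , extended) with
    common (p≢q ∘ lookup-injective unique)
      (does-false⁻ (adj? G _ _) (trans (sym (⟦adjTable⟧ G (s ∷ t ∷ x ∷ y ∷ a ∷ b ∷ []) p q)) ¬pq))
  ...   | z , pz , qz = good⇒spread (All.tabulate z≢ ∷ unique)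
                          (good-resp (⟦adjTable⟧ G (z ∷ xs)) (extended _
                            (row p (adj-sym G pz) , row q (adj-sym G qz))))
    where
    xs = s ∷ t ∷ x ∷ y ∷ a ∷ b ∷ []
    row : ∀ i → Adj G z (List.lookup xs i) → Vec.lookup (proj₁ (adjTable G (z ∷ xs))) i ≡ true
    row i zi = trans (lookup∘tabulate (adjMatrix G (z ∷ xs) zero ∘ suc) i) (dec-true (adj? G _ _) zi)
    entry : ∀ i {v} (v∈ : v ∈ xs) → Adj G (List.lookup xs i) v →
            ⟦ adjTable G xs ⟧ i (Any.index v∈) ≡ true
    entry i v∈ iv = trans (⟦adjTable⟧ G xs i _)
      (dec-true (adj? G _ _) (subst (Adj G _) (lookup-index v∈) iv))
    -- If `z` were one of the six vertices, it would be a common neighbour of `p` and `q` inside the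
    -- table, against `none`.
    z≢ : ∀ {v} → v ∈ xs → z ≢ v
    z≢ v∈ refl = none (Any.index v∈) (entry p v∈ pz , entry q v∈ qz)

-- A vertex at distance three

-- The complement graph has no vertex cover of size at most two; `x` and `y` may coincide.
Avoiding : Graph n → Set
Avoiding G = ∀ x y → ∃₂ λ s t → (s ∉ x ∷ y ∷ []) × (t ∉ x ∷ y ∷ []) × s ≢ t × ¬ Adj G s t

-- If no nonadjacent pair avoided `x` and `y`, the remaining vertices would form a clique with at
-- least `n ∸ 2` elements.
ω≤n∸3⇒avoiding : (G : Graph n) → 5 ≤ n → ω G ≤ n ∸ 3 → Avoiding G
ω≤n∸3⇒avoiding {n} G 5≤n ω≤ x y with any? (λ s → any? λ t →
  ¬? (s ∈? (x ∷ y ∷ [])) ×-dec ¬? (t ∈? (x ∷ y ∷ [])) ×-dec ¬? (s ≟ t) ×-dec ¬? (adj? G s t))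
... | yes found = found
-- As subtraction is truncated, `3 ≤ n` is what makes `n ∸ 3` smaller than `n ∸ 2`.
... | no ¬found = contradiction size
  (<⇒≱ (∸-monoʳ-< (s≤s (s≤s (s≤s z≤n))) (≤-trans (s≤s (s≤s (s≤s z≤n))) 5≤n)))
  where
  xy = ⁅ x ⁆ ∪ ⁅ y ⁆

  ∣xy∣≤2 : ∣ xy ∣ ≤ 2
  ∣xy∣≤2 = injectiveOn⇒∣S∣≤ xy label injective
    where
    label : Fin n → Fin 2
    label v with v ≟ x
    ... | yes _ = zero
    ... | no  _ = suc zero
    injective : ∀ {u v} → u Subset.∈ xy → v Subset.∈ xy → label u ≡ label v → u ≡ v
    injective {u} {v} u∈ v∈ eq with u ≟ x | v ≟ x | x∈p∪q⁻ ⁅ x ⁆ ⁅ y ⁆ u∈ | x∈p∪q⁻ ⁅ x ⁆ ⁅ y ⁆ v∈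
    ... | yes u≡x | yes v≡x | _ | _ = trans u≡x (sym v≡x)
    ... | no u≢x | _ | inj₁ u∈x | _ = contradiction (x∈⁅y⁆⇒x≡y x u∈x) u≢x
    ... | _ | no v≢x | _ | inj₁ v∈x = contradiction (x∈⁅y⁆⇒x≡y x v∈x) v≢x
    ... | no _ | no _ | inj₂ u∈y | inj₂ v∈y = trans (x∈⁅y⁆⇒x≡y y u∈y) (sym (x∈⁅y⁆⇒x≡y y v∈y))

  ∉xy : ∀ {u} → u Subset.∈ ∁ xy → u ∉ x ∷ y ∷ []
  ∉xy u∈ (here refl)         = x∈∁p⇒x∉p u∈ (x∈p∪q⁺ (inj₁ (x∈⁅x⁆ x)))
  ∉xy u∈ (there (here refl)) = x∈∁p⇒x∉p u∈ (x∈p∪q⁺ (inj₂ (x∈⁅x⁆ y)))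

  clique : IsClique G (∁ xy)
  clique u v u∈ v∈ u≢v = decidable-stable (adj? G u v) λ ¬a →
    ¬found (u , v , ∉xy u∈ , ∉xy v∈ , u≢v , ¬a)

  size : n ∸ 2 ≤ n ∸ 3
  size = begin
    n ∸ 2      ≤⟨ ∸-monoʳ-≤ n ∣xy∣≤2 ⟩
    n ∸ ∣ xy ∣ ≡⟨ ∣∁p∣≡n∸∣p∣ xy ⟨
    ∣ ∁ xy ∣   ≤⟨ proj₂ (proj₂ (cliqueNumber G)) _ (∁ xy , clique , refl) ⟩
    ω G        ≤⟨ ω≤ ⟩
    n ∸ 3      ∎
    where open ≤-Reasoning

module Extremal (G : Graph n) (conn : Connected G) (avoiding : Avoiding G)
  (bad : ∀ U → Metric.Spread G conn U → List.length U ≢ 4) where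

  open Metric G conn

  ∉₄ : {w a b c e : Fin n} → w ≢ a → w ≢ b → w ≢ c → w ≢ e → w ∉ a ∷ b ∷ c ∷ e ∷ []
  ∉₄ p q r s = All¬⇒¬Any (p ∷ q ∷ r ∷ s ∷ [])

  Sep≢ : List (Fin n) → Fin n → Fin n → Set
  Sep≢ U u v = u ≢ v × Separated U u v

  bad₄ : ∀ {a b c e} (let U = a ∷ b ∷ c ∷ e ∷ []) →
         Sep≢ U a b → Sep≢ U a c → Sep≢ U a e → Sep≢ U b c → Sep≢ U b e → Sep≢ U c e → ⊥
  bad₄ ab ac ae bc be ce = bad _ ((ab ∷ ac ∷ ae ∷ []) ∷ (bc ∷ be ∷ []) ∷ (ce ∷ []) ∷ [] ∷ []) refl

  module Levels (r : Fin n) where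

    ℓ : Fin n → ℕ
    ℓ v = d v r

    ℓ≢⇒≢ : ∀ {u v i j} → ℓ u ≡ i → ℓ v ≡ j → i ≢ j → u ≢ v
    ℓ≢⇒≢ u≡ v≡ i≢j refl = i≢j (trans (sym u≡) v≡)

    far : ∀ {u v i j} → ℓ u ≡ i → ℓ v ≡ j → suc j < i → ¬ Adj G u v
    far refl refl lt a = <⇒≱ lt (dist-step a)

    r∉ : ∀ {U} → All (λ v → ∃ λ i → ℓ v ≡ suc i) U → r ∉ U
    r∉ positive r∈ with All.lookup positive r∈
    ... | _ , eq = contradiction (trans (sym (dist-refl r)) eq) λ ()

    -- Vertices of different levels are told apart by `r` itself.
    sepℓ : ∀ {U u v i j} → r ∉ U → ℓ u ≡ i → ℓ v ≡ j → i ≢ j → Sep≢ U u v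
    sepℓ r∉U u≡ v≡ i≢j =
      ℓ≢⇒≢ u≡ v≡ i≢j , inj₂ (r , r∉U , λ eq → i≢j (trans (sym u≡) (trans eq v≡)))

    -- A geodesic from `v` to `r` passes through every lower level.
    level : ∀ {v} k → k ≤ ℓ v → ∃ λ u → ℓ u ≡ k
    level {v} k k≤ with m≤n⇒∃[o]m+o≡n k≤
    ... | o , eq = go o v (trans (sym eq) (+-comm k o))
      where
      go : ∀ o v → ℓ v ≡ o + k → ∃ λ u → ℓ u ≡ k
      go zero    v eq = v , eq
      go (suc o) v eq with dist-pred eq
      ... | u , _ , eq′ = go o u eq′

    -- Among two vertices of one positive level and one vertex from each of two others, `r`
    -- separates every pair except `u`, `v`. Separating these as well would make the four vertices
    -- spread.
    same-level : ∀ {i j k u v p q} → ℓ u ≡ suc i → ℓ v ≡ suc i → ℓ p ≡ suc j → ℓ q ≡ suc k →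
                 i ≢ j → i ≢ k → j ≢ k → u ≢ v → ¬ Separated (u ∷ v ∷ p ∷ q ∷ []) u v
    same-level u≡ v≡ p≡ q≡ i≢j i≢k j≢k u≢v sep = bad₄ (u≢v , sep)
      (sepℓ r∉U u≡ p≡ (i≢j ∘ ℕ.suc-injective)) (sepℓ r∉U u≡ q≡ (i≢k ∘ ℕ.suc-injective))
      (sepℓ r∉U v≡ p≡ (i≢j ∘ ℕ.suc-injective)) (sepℓ r∉U v≡ q≡ (i≢k ∘ ℕ.suc-injective))
      (sepℓ r∉U p≡ q≡ (j≢k ∘ ℕ.suc-injective))
      where r∉U = r∉ ((_ , u≡) ∷ (_ , v≡) ∷ (_ , p≡) ∷ (_ , q≡) ∷ [])

  module Deep {r v₀ : Fin n} (3≤ : 3 ≤ d v₀ r) where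

    open Levels r

    module Chain {x₁ x₂ x₃ : Fin n} (ℓx₁ : ℓ x₁ ≡ 1) (ℓx₂ : ℓ x₂ ≡ 2) (ℓx₃ : ℓ x₃ ≡ 3)
      (x₂x₁ : Adj G x₂ x₁) (x₃x₂ : Adj G x₃ x₂) where

      -- Otherwise one vertex from each of the levels one to four would give a spread set.
      ℓ≤3 : ∀ v → ℓ v ≤ 3
      ℓ≤3 v with ℓ v ≤? 3
      ... | yes le = le
      ... | no ≰3 with level 4 (≰⇒> ≰3)
      ...   | x₄ , ℓx₄ = contradiction
        ((sepℓ r∉U ℓx₁ ℓx₂ (λ ()) ∷ sepℓ r∉U ℓx₁ ℓx₃ (λ ()) ∷ sepℓ r∉U ℓx₁ ℓx₄ (λ ()) ∷ [])
          ∷ (sepℓ r∉U ℓx₂ ℓx₃ (λ ()) ∷ sepℓ r∉U ℓx₂ ℓx₄ (λ ()) ∷ [])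
          ∷ (sepℓ r∉U ℓx₃ ℓx₄ (λ ()) ∷ []) ∷ [] ∷ [])
        (λ spread → bad _ spread refl)
        where r∉U = r∉ ((_ , ℓx₁) ∷ (_ , ℓx₂) ∷ (_ , ℓx₃) ∷ (_ , ℓx₄) ∷ [])

      levels : ∀ v → ℓ v ≡ 0 ⊎ ℓ v ≡ 1 ⊎ ℓ v ≡ 2 ⊎ ℓ v ≡ 3
      levels v with ℓ v | ℓ≤3 v
      ... | 0 | _ = inj₁ refl
      ... | 1 | _ = inj₂ (inj₁ refl)
      ... | 2 | _ = inj₂ (inj₂ (inj₁ refl))
      ... | 3 | _ = inj₂ (inj₂ (inj₂ refl))
      ... | suc (suc (suc (suc _))) | s≤s (s≤s (s≤s ()))

      ℓ≡0 : ∀ {v} → ℓ v ≡ 0 → v ≡ r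
      ℓ≡0 = dist≡0⇒≡

      -- A nonadjacent pair counts as separated, so `same-level` applies with the chain vertices of
      -- the two other positive levels.
      clique : ∀ i {u v} → ℓ u ≡ suc i → ℓ v ≡ suc i → u ≢ v → Adj G u v
      clique i {u} {v} u≡ v≡ u≢v = decidable-stable (adj? G u v) (go i u≡ v≡)
        where
        go : ∀ i → ℓ u ≡ suc i → ℓ v ≡ suc i → ¬ ¬ Adj G u v
        go 0 u≡ v≡ ¬a = same-level u≡ v≡ ℓx₂ ℓx₃ (λ ()) (λ ()) (λ ()) u≢v (inj₁ ¬a)
        go 1 u≡ v≡ ¬a = same-level u≡ v≡ ℓx₁ ℓx₃ (λ ()) (λ ()) (λ ()) u≢v (inj₁ ¬a)
        go 2 u≡ v≡ ¬a = same-level u≡ v≡ ℓx₁ ℓx₂ (λ ()) (λ ()) (λ ()) u≢v (inj₁ ¬a)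
        go (suc (suc (suc i))) u≡ _ _ with subst (_≤ 3) u≡ (ℓ≤3 u)
        ... | s≤s (s≤s (s≤s ()))

      adj-root : ∀ {u v} → ℓ u ≡ 0 → ℓ v ≡ 1 → Adj G v u
      adj-root u≡ v≡ = subst (Adj G _) (sym (ℓ≡0 u≡)) (dist≡1⇒adj v≡)

      module Wide {z : Fin n} (ℓz : ℓ z ≡ 3) (z≢x₃ : z ≢ x₃) where

        -- If `s` and `t` were nonadjacent, `t` would separate `s` from a level-two neighbour `s′`
        -- of `t`. A second vertex `q` of level three completes the four-set, so `t` stays outside
        -- it.
        level₂₃ : ∀ {s t} → ℓ s ≡ 2 → ℓ t ≡ 3 → Adj G s t
        level₂₃ {s} {t} s≡ t≡ = decidable-stable (adj? G s t) λ ¬st → absurd ¬st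
          where
          absurd : ¬ ¬ Adj G s t
          absurd ¬st with dist-pred t≡
          ... | s′ , ts′ , s′≡ = go other
            where
            other : ∃ λ q → ℓ q ≡ 3 × t ≢ q
            other with t ≟ x₃
            ... | yes refl = z , ℓz , ≢-sym z≢x₃
            ... | no t≢x₃  = x₃ , ℓx₃ , t≢x₃
            go : (∃ λ q → ℓ q ≡ 3 × t ≢ q) → ⊥
            go (q , q≡ , t≢q) = same-level s≡ s′≡ ℓx₁ q≡ (λ ()) (λ ()) (λ ())
              (λ { refl → ¬st (adj-sym G ts′) })
              (sepʳ (∉₄ (ℓ≢⇒≢ t≡ s≡ λ ()) (ℓ≢⇒≢ t≡ s′≡ λ ()) (ℓ≢⇒≢ t≡ ℓx₁ λ ()) t≢q)
                ¬st (adj-sym G ts′))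

        -- Levels two and three together form a clique, so a nonadjacent pair avoiding `r` and `x₁`
        -- has an end in level one.
        second₁ : ∃ λ y → ℓ y ≡ 1 × y ≢ x₁
        second₁ with avoiding r x₁
        ... | s , t , s∉ , t∉ , s≢t , ¬st with levels s | levels t
        ... | inj₁ s≡ | _ = contradiction (here (ℓ≡0 s≡)) s∉
        ... | _ | inj₁ t≡ = contradiction (here (ℓ≡0 t≡)) t∉
        ... | inj₂ (inj₁ s≡) | _ = s , s≡ , s∉ ∘ there ∘ here
        ... | _ | inj₂ (inj₁ t≡) = t , t≡ , t∉ ∘ there ∘ here
        ... | inj₂ (inj₂ (inj₁ s≡)) | inj₂ (inj₂ (inj₁ t≡)) = contradiction (clique 1 s≡ t≡ s≢t) ¬st
        ... | inj₂ (inj₂ (inj₂ s≡)) | inj₂ (inj₂ (inj₂ t≡)) = contradiction (clique 2 s≡ t≡ s≢t) ¬st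
        ... | inj₂ (inj₂ (inj₁ s≡)) | inj₂ (inj₂ (inj₂ t≡)) = contradiction (level₂₃ s≡ t≡) ¬st
        ... | inj₂ (inj₂ (inj₂ s≡)) | inj₂ (inj₂ (inj₁ t≡)) =
          contradiction (adj-sym G (level₂₃ t≡ s≡)) ¬st

        -- The geodesic from `r` to `x₃` is itself spread: `z` has distance three from `r`, two from
        -- `x₁` and one from `x₂`, while `y` separates `x₂` from `x₃`.
        absurd : ⊥
        absurd with second₁
        ... | y , ℓy , y≢x₁ = bad₄
          (ℓ≢⇒≢ ℓr ℓx₁ (λ ()) , inj₂ (z , z∉ , rz≢x₁z))
          (ℓ≢⇒≢ ℓr ℓx₂ (λ ()) , inj₁ (far ℓx₂ ℓr ≤-refl ∘ adj-sym G))
          (ℓ≢⇒≢ ℓr ℓx₃ (λ ()) , inj₁ (far ℓx₃ ℓr (s≤s (s≤s z≤n)) ∘ adj-sym G))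
          (ℓ≢⇒≢ ℓx₁ ℓx₂ (λ ()) , sepʳ z∉ (far ℓz ℓx₁ ≤-refl ∘ adj-sym G) (level₂₃ ℓx₂ ℓz))
          (ℓ≢⇒≢ ℓx₁ ℓx₃ (λ ()) , inj₁ (far ℓx₃ ℓx₁ ≤-refl ∘ adj-sym G))
          (ℓ≢⇒≢ ℓx₂ ℓx₃ (λ ()) , inj₂ (y , y∉ , x₂y≢x₃y))
          where
          ℓr : ℓ r ≡ 0
          ℓr = dist-refl r
          z∉ : z ∉ r ∷ x₁ ∷ x₂ ∷ x₃ ∷ []
          z∉ = ∉₄ (ℓ≢⇒≢ ℓz ℓr λ ()) (ℓ≢⇒≢ ℓz ℓx₁ λ ()) (ℓ≢⇒≢ ℓz ℓx₂ λ ()) z≢x₃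
          y∉ : y ∉ r ∷ x₁ ∷ x₂ ∷ x₃ ∷ []
          y∉ = ∉₄ (ℓ≢⇒≢ ℓy ℓr λ ()) y≢x₁ (ℓ≢⇒≢ ℓy ℓx₂ λ ()) (ℓ≢⇒≢ ℓy ℓx₃ λ ())
          rz≢x₁z : d r z ≢ d x₁ z
          rz≢x₁z eq = <⇒≱ (≤-reflexive (trans (sym ℓz) (trans (dist-sym z r) eq)))
            (≤-trans (dist-step (adj-sym G x₂x₁)) (s≤s (≤-reflexive (adj⇒dist≡1 (level₂₃ ℓx₂ ℓz)))))
          ¬x₃y : ¬ Adj G x₃ y
          ¬x₃y = far ℓx₃ ℓy ≤-refl
          x₂y≢x₃y : d x₂ y ≢ d x₃ y
          x₂y≢x₃y eq with adj? G x₂ y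
          ... | yes x₂y = adj-differs x₂y ¬x₃y eq
          ... | no ¬x₂y with d x₃ y in x₃y≡ | subst (_≤ 2) eq (≤-trans (dist-step x₂x₁)
                  (s≤s (≤-reflexive (adj⇒dist≡1 (clique 0 ℓx₁ ℓy (≢-sym y≢x₁))))))
          ...   | 0 | _ = ℓ≢⇒≢ ℓx₃ ℓy (λ ()) (dist≡0⇒≡ x₃y≡)
          ...   | 1 | _ = ¬x₃y (dist≡1⇒adj x₃y≡)
          ...   | suc (suc (suc _)) | s≤s (s≤s ())
          -- A common neighbour `c` of `x₃` and `y` lies in level two and differs from `x₂`. Then
          -- `x₂` separates `x₁` from `y`, outside the set `x₁`, `y`, `c`, `x₃`.
          ...   | 2 | _ with dist-pred x₃y≡
          ...     | c , x₃c , cy≡ = same-level ℓx₁ ℓy ℓc ℓx₃ (λ ()) (λ ()) (λ ()) (≢-sym y≢x₁)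
            (sepˡ (∉₄ (ℓ≢⇒≢ ℓx₂ ℓx₁ λ ()) (ℓ≢⇒≢ ℓx₂ ℓy λ ()) x₂≢c (ℓ≢⇒≢ ℓx₂ ℓx₃ λ ()))
              (adj-sym G x₂x₁) (¬x₂y ∘ adj-sym G))
            where
            cy : Adj G c y
            cy = dist≡1⇒adj cy≡
            ℓc : ℓ c ≡ 2
            ℓc = ≤-antisym (≤-trans (dist-step cy) (s≤s (≤-reflexive ℓy)))
                           (ℕ.s≤s⁻¹ (≤-trans (≤-reflexive (sym ℓx₃)) (dist-step x₃c)))
            x₂≢c : x₂ ≢ c
            x₂≢c refl = ¬x₂y cy

      module Narrow (unique₃ : ∀ {v} → ℓ v ≡ 3 → v ≡ x₃) where

        -- The root and level one form a clique and `x₃` is alone in its level, so a nonadjacent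
        -- pair avoiding `x₂` and `x₃` has an end in level two.
        second₂ : ∃ λ y → ℓ y ≡ 2 × x₂ ≢ y
        second₂ with avoiding x₂ x₃
        ... | s , t , s∉ , t∉ , s≢t , ¬st with levels s | levels t
        ... | inj₂ (inj₂ (inj₂ s≡)) | _ = contradiction (there (here (unique₃ s≡))) s∉
        ... | _ | inj₂ (inj₂ (inj₂ t≡)) = contradiction (there (here (unique₃ t≡))) t∉
        ... | inj₂ (inj₂ (inj₁ s≡)) | _ = s , s≡ , s∉ ∘ here ∘ sym
        ... | _ | inj₂ (inj₂ (inj₁ t≡)) = t , t≡ , t∉ ∘ here ∘ sym
        ... | inj₁ s≡ | inj₁ t≡ = contradiction (trans (ℓ≡0 s≡) (sym (ℓ≡0 t≡))) s≢t
        ... | inj₁ s≡ | inj₂ (inj₁ t≡) = contradiction (adj-sym G (adj-root s≡ t≡)) ¬st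
        ... | inj₂ (inj₁ s≡) | inj₁ t≡ = contradiction (adj-root t≡ s≡) ¬st
        ... | inj₂ (inj₁ s≡) | inj₂ (inj₁ t≡) = contradiction (clique 0 s≡ t≡ s≢t) ¬st

        -- As in `level₂₃`, one level lower: `t` would separate `s` from its own neighbour `s′` in
        -- level one, with a second vertex of level two in the four-set.
        level₁₂ : ∀ {s t} → ℓ s ≡ 1 → ℓ t ≡ 2 → Adj G s t
        level₁₂ {s} {t} s≡ t≡ = decidable-stable (adj? G s t) λ ¬st → absurd ¬st
          where
          other : ∃ λ p → ℓ p ≡ 2 × t ≢ p
          other with t ≟ x₂
          ... | yes refl = second₂
          ... | no t≢x₂  = x₂ , ℓx₂ , t≢x₂
          absurd : ¬ ¬ Adj G s t
          absurd ¬st with dist-pred t≡ | other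
          ... | s′ , ts′ , s′≡ | p , p≡ , t≢p = same-level s≡ s′≡ p≡ ℓx₃ (λ ()) (λ ()) (λ ())
            (λ { refl → ¬st (adj-sym G ts′) })
            (sepʳ (∉₄ (ℓ≢⇒≢ t≡ s≡ λ ()) (ℓ≢⇒≢ t≡ s′≡ λ ()) t≢p (ℓ≢⇒≢ t≡ ℓx₃ λ ()))
              ¬st (adj-sym G ts′))

        -- Without `r` and `x₃` only levels one and two remain. Together they form a clique, so `r`
        -- and `x₃` cannot be avoided.
        absurd : ⊥
        absurd with avoiding r x₃
        ... | s , t , s∉ , t∉ , s≢t , ¬st with levels s | levels t
        ... | inj₁ s≡ | _ = s∉ (here (ℓ≡0 s≡))
        ... | _ | inj₁ t≡ = t∉ (here (ℓ≡0 t≡))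
        ... | inj₂ (inj₂ (inj₂ s≡)) | _ = s∉ (there (here (unique₃ s≡)))
        ... | _ | inj₂ (inj₂ (inj₂ t≡)) = t∉ (there (here (unique₃ t≡)))
        ... | inj₂ (inj₁ s≡) | inj₂ (inj₁ t≡) = ¬st (clique 0 s≡ t≡ s≢t)
        ... | inj₂ (inj₂ (inj₁ s≡)) | inj₂ (inj₂ (inj₁ t≡)) = ¬st (clique 1 s≡ t≡ s≢t)
        ... | inj₂ (inj₁ s≡) | inj₂ (inj₂ (inj₁ t≡)) = ¬st (level₁₂ s≡ t≡)
        ... | inj₂ (inj₂ (inj₁ s≡)) | inj₂ (inj₁ t≡) = ¬st (adj-sym G (level₁₂ t≡ s≡))

      absurd : ⊥
      absurd with any? (λ z → (ℓ z ℕ.≟ 3) ×-dec ¬? (z ≟ x₃))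
      ... | yes (z , ℓz , z≢x₃) = Wide.absurd ℓz z≢x₃
      ... | no none = Narrow.absurd λ {v} ℓv →
        decidable-stable (v ≟ x₃) λ v≢x₃ → none (v , ℓv , v≢x₃)

    absurd : ⊥
    absurd with level 3 3≤
    ... | x₃ , ℓx₃ with dist-pred ℓx₃
    ...   | x₂ , x₃x₂ , ℓx₂ with dist-pred ℓx₂
    ...     | x₁ , x₂x₁ , ℓx₁ = Chain.absurd ℓx₁ ℓx₂ ℓx₃ x₂x₁ x₃x₂

  opaque
    dist≤2 : ∀ u v → d u v ≤ 2
    dist≤2 u v = decidable-stable (d u v ≤? 2) (Deep.absurd ∘ ≰⇒>)

-- Diameter two

-- If the complement of G has no vertex cover of size two, then any two disjoint nonadjacent
-- pairs extend to a set of six vertices with the same property.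
module TwoPairs (G : Graph n) (avoiding : Avoiding G) (6≤n : 6 ≤ n) {u₁ v₁ u₂ v₂ : Fin n}
  (unique : Unique (u₁ ∷ v₁ ∷ u₂ ∷ v₂ ∷ [])) where

  S : List (Fin n)
  S = u₁ ∷ v₁ ∷ u₂ ∷ v₂ ∷ []

  Out : Fin n → Set
  Out p = ∃ λ w → w ∉ S × ¬ Adj G p w

  out? : ∀ p → Dec (Out p)
  out? p = any? λ w → ¬? (w ∈? S) ×-dec ¬? (adj? G p w)

  Hit : Fin n → Fin n → Fin n → Set
  Hit s t p = ¬ Adj G p s ⊎ ¬ Adj G p t

  Outside : Fin n → Fin n → Set
  Outside s t = s ∉ S × t ∉ S × s ≢ t

  -- Each of `p` and `q` gets a nonneighbour outside `S` if it has one, and any vertex outside `S`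
  -- otherwise. If the two choices agree, a sixth vertex serves as `t`.
  hitting : ∀ p q → ∃₂ λ s t → Outside s t × (Out p → Hit s t p) × (Out q → Hit s t q)
  hitting p q with pick p | pick q
    where
    pick : ∀ p → ∃ λ w → w ∉ S × (Out p → ¬ Adj G p w)
    pick p with out? p
    ... | yes (w , w∉ , ¬pw) = w , w∉ , λ _ → ¬pw
    ... | no ¬out with fresh S (<⇒≤ 6≤n)
    ...   | w , w∉ = w , w∉ , λ out → contradiction out ¬out
  ... | s , s∉ , hs | t , t∉ , ht with s ≟ t
  ...   | no s≢t = s , t , (s∉ , t∉ , s≢t) , inj₁ ∘ hs , inj₂ ∘ ht
  ...   | yes refl with fresh (s ∷ S) 6≤n
  ...     | t′ , t′∉ = s , t′ , (s∉ , t′∉ ∘ there , t′∉ ∘ here ∘ sym) , inj₁ ∘ hs , inj₁ ∘ ht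

  Evidence : Fin n → Fin n → Fin n → Fin n → Set
  Evidence s t p q = ¬ Adj G p q ⊎ Hit s t p ⊎ Hit s t q

  -- The permutation splits `S` into the candidate cover `p`, `q` and the rest `p′`, `q′`. The cover
  -- misses the pair `p′`, `q′`, or a pair joining one of these to `s` or `t`.
  missed : ∀ {s t p p′ q q′} → Outside s t → (p ∷ p′ ∷ q ∷ q′ ∷ []) ↭ S →
           Evidence s t p′ q′ → Missed G (s ∷ t ∷ S) p q
  missed {s} {t} {p} {p′} {q} {q′} (s∉ , t∉ , _) perm evidence
    with Unique-resp-↭ (setoid _) (↭⇒↭ₛ (↭-sym perm)) unique
  ... | (p≢p′ ∷ p≢q ∷ p≢q′ ∷ []) ∷ (p′≢q ∷ p′≢q′ ∷ []) ∷ (q≢q′ ∷ []) ∷ [] ∷ [] = go evidence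
    where
    p∈ : p ∈ S
    p∈ = ∈-resp-↭ perm (here refl)
    p′∈ : p′ ∈ S
    p′∈ = ∈-resp-↭ perm (there (here refl))
    q∈ : q ∈ S
    q∈ = ∈-resp-↭ perm (there (there (here refl)))
    q′∈ : q′ ∈ S
    q′∈ = ∈-resp-↭ perm (there (there (there (here refl))))

    ∉S⇒∉pq : ∀ {w} → w ∉ S → w ∉ p ∷ q ∷ []
    ∉S⇒∉pq w∉ (here refl)         = w∉ p∈
    ∉S⇒∉pq w∉ (there (here refl)) = w∉ q∈

    p′∉pq : p′ ∉ p ∷ q ∷ []
    p′∉pq (here eq)         = p≢p′ (sym eq)
    p′∉pq (there (here eq)) = p′≢q eq

    q′∉pq : q′ ∉ p ∷ q ∷ []
    q′∉pq (here eq)         = p≢q′ (sym eq)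
    q′∉pq (there (here eq)) = q≢q′ (sym eq)

    hit : ∀ {r} → r ∈ S → r ∉ p ∷ q ∷ [] → Hit s t r → Missed G (s ∷ t ∷ S) p q
    hit {r} r∈ r∉ (inj₁ ¬rs) =
      r , s , there (there r∈) , here refl , (λ { refl → s∉ r∈ }) , ¬rs , r∉ , ∉S⇒∉pq s∉
    hit {r} r∈ r∉ (inj₂ ¬rt) =
      r , t , there (there r∈) , there (here refl) , (λ { refl → t∉ r∈ }) , ¬rt , r∉ , ∉S⇒∉pq t∉

    go : Evidence s t p′ q′ → Missed G (s ∷ t ∷ S) p q
    go (inj₁ ¬p′q′)       =
      p′ , q′ , there (there p′∈) , there (there q′∈) , p′≢q′ , ¬p′q′ , p′∉pq , q′∉pq
    go (inj₂ (inj₁ hits)) = hit p′∈ p′∉pq hits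
    go (inj₂ (inj₂ hits)) = hit q′∈ q′∉pq hits

  Thickened : Set
  Thickened = ∃₂ λ s t → Outside s t ×
    Missed G (s ∷ t ∷ S) u₁ u₂ × Missed G (s ∷ t ∷ S) u₁ v₂ ×
    Missed G (s ∷ t ∷ S) v₁ u₂ × Missed G (s ∷ t ∷ S) v₁ v₂

  module Perms {A : Set} (a b c e : A) where
    swap₁ : (b ∷ a ∷ c ∷ e ∷ []) ↭ (a ∷ b ∷ c ∷ e ∷ [])
    swap₁ = swap b a ↭-refl
    swap₂ : (a ∷ b ∷ e ∷ c ∷ []) ↭ (a ∷ b ∷ c ∷ e ∷ [])
    swap₂ = prep a (prep b (swap e c ↭-refl))
    swap₁₂ : (b ∷ a ∷ e ∷ c ∷ []) ↭ (a ∷ b ∷ c ∷ e ∷ [])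
    swap₁₂ = swap b a (swap e c ↭-refl)

  open Perms u₁ v₁ u₂ v₂

  module _ (no-pair-outside : ∀ {s t} → Outside s t → Adj G s t) where

    -- The nonadjacent pair avoiding `p` and `q` does not lie entirely outside `S`, so it has an end
    -- at `p′` or `q′`.
    surviving : ∀ {p p′ q q′} → (p ∷ p′ ∷ q ∷ q′ ∷ []) ↭ S → ¬ Adj G p′ q′ ⊎ Out p′ ⊎ Out q′
    surviving {p} {p′} {q} {q′} perm with avoiding p q
    ... | s , t , s∉ , t∉ , s≢t , ¬st = go (s ∈? S) (t ∈? S)
      where
      other : ∀ {w} → w ∉ p ∷ q ∷ [] → w ∈ S → w ≡ p′ ⊎ w ≡ q′
      other w∉ w∈ with ∈-resp-↭ (↭-sym perm) w∈
      ... | here eq                         = contradiction (here eq) w∉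
      ... | there (here eq)                 = inj₁ eq
      ... | there (there (here eq))         = contradiction (there (here eq)) w∉
      ... | there (there (there (here eq))) = inj₂ eq

      go : Dec (s ∈ S) → Dec (t ∈ S) → ¬ Adj G p′ q′ ⊎ Out p′ ⊎ Out q′
      go (no s∉S) (no t∉S) = contradiction (no-pair-outside (s∉S , t∉S , s≢t)) ¬st
      go (yes s∈) (no t∉S) with other s∉ s∈
      ... | inj₁ refl = inj₂ (inj₁ (t , t∉S , ¬st))
      ... | inj₂ refl = inj₂ (inj₂ (t , t∉S , ¬st))
      go (no s∉S) (yes t∈) with other t∉ t∈
      ... | inj₁ refl = inj₂ (inj₁ (s , s∉S , ¬st ∘ adj-sym G))
      ... | inj₂ refl = inj₂ (inj₂ (s , s∉S , ¬st ∘ adj-sym G))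
      go (yes s∈) (yes t∈) with other s∉ s∈ | other t∉ t∈
      ... | inj₁ refl | inj₁ refl = contradiction refl s≢t
      ... | inj₁ refl | inj₂ refl = inj₁ ¬st
      ... | inj₂ refl | inj₁ refl = inj₁ (¬st ∘ adj-sym G)
      ... | inj₂ refl | inj₂ refl = contradiction refl s≢t

    evidence : ∀ {s t p p′ q q′} → (p ∷ p′ ∷ q ∷ q′ ∷ []) ↭ S →
               (Out p′ → Hit s t p′) → (Out q′ → Hit s t q′) → Evidence s t p′ q′
    evidence perm hitp′ hitq′ with surviving perm
    ... | inj₁ ¬p′q′        = inj₁ ¬p′q′
    ... | inj₂ (inj₁ outp′) = inj₂ (inj₁ (hitp′ outp′))
    ... | inj₂ (inj₂ outq′) = inj₂ (inj₂ (hitq′ outq′))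

    thicken : ∀ {s t} → Outside s t → (Out u₁ → Hit s t u₁) → (Out v₁ → Hit s t v₁) →
              (Out u₂ → Hit s t u₂) → (Out v₂ → Hit s t v₂) → Thickened
    thicken out hu₁ hv₁ hu₂ hv₂ = _ , _ , out ,
      missed out ↭-refl (evidence ↭-refl hv₁ hv₂) , missed out swap₂ (evidence swap₂ hv₁ hu₂) ,
      missed out swap₁ (evidence swap₁ hu₁ hv₂) , missed out swap₁₂ (evidence swap₁₂ hu₁ hu₂)

    -- It suffices to hit two of the four vertices. Every candidate cover omits `u₁` or `v₁`, so
    -- hitting both is enough if both are `Out`; likewise for `u₂` and `v₂`. Otherwise each pair has
    -- a vertex that is not `Out`, and the other two are hit.
    thickened′ : Thickened
    thickened′ with out? u₁ | out? v₁ | out? u₂ | out? v₂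
    thickened′ | yes ou₁ | yes ov₁ | _ | _ with hitting u₁ v₁
    ... | s , t , out , hu₁ , hv₁ = s , t , out ,
      missed out ↭-refl (inj₂ (inj₁ (hv₁ ov₁))) , missed out swap₂ (inj₂ (inj₁ (hv₁ ov₁))) ,
      missed out swap₁ (inj₂ (inj₁ (hu₁ ou₁))) , missed out swap₁₂ (inj₂ (inj₁ (hu₁ ou₁)))
    thickened′ | _ | _ | yes ou₂ | yes ov₂ with hitting u₂ v₂
    ... | s , t , out , hu₂ , hv₂ = s , t , out ,
      missed out ↭-refl (inj₂ (inj₂ (hv₂ ov₂))) , missed out swap₂ (inj₂ (inj₂ (hu₂ ou₂))) ,
      missed out swap₁ (inj₂ (inj₂ (hv₂ ov₂))) , missed out swap₁₂ (inj₂ (inj₂ (hu₂ ou₂)))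
    thickened′ | no ¬u₁ | _ | no ¬u₂ | _ with hitting v₁ v₂
    ... | s , t , out , hv₁ , hv₂ = thicken out (⊥-elim ∘ ¬u₁) hv₁ (⊥-elim ∘ ¬u₂) hv₂
    thickened′ | no ¬u₁ | _ | _ | no ¬v₂ with hitting v₁ u₂
    ... | s , t , out , hv₁ , hu₂ = thicken out (⊥-elim ∘ ¬u₁) hv₁ hu₂ (⊥-elim ∘ ¬v₂)
    thickened′ | _ | no ¬v₁ | no ¬u₂ | _ with hitting u₁ v₂
    ... | s , t , out , hu₁ , hv₂ = thicken out hu₁ (⊥-elim ∘ ¬v₁) (⊥-elim ∘ ¬u₂) hv₂
    thickened′ | _ | no ¬v₁ | _ | no ¬v₂ with hitting u₁ u₂
    ... | s , t , out , hu₁ , hu₂ = thicken out hu₁ (⊥-elim ∘ ¬v₁) hu₂ (⊥-elim ∘ ¬v₂)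

  -- A nonadjacent pair outside `S` is missed by all four candidate covers at once; without one,
  -- `thickened′` applies.
  thickened : Thickened
  thickened with any? (λ s → any? λ t →
    ¬? (s ∈? S) ×-dec ¬? (t ∈? S) ×-dec ¬? (s ≟ t) ×-dec ¬? (adj? G s t))
  ... | no none = thickened′ λ (s∉ , t∉ , s≢t) →
    decidable-stable (adj? G _ _) λ ¬st → none (_ , _ , s∉ , t∉ , s≢t , ¬st)
  ... | yes (s , t , s∉ , t∉ , s≢t , ¬st) =
    s , t , (s∉ , t∉ , s≢t) ,
    outsideBoth (here refl) (there (there (here refl))) ,
    outsideBoth (here refl) (there (there (there (here refl)))) ,
    outsideBoth (there (here refl)) (there (there (here refl))) ,
    outsideBoth (there (here refl)) (there (there (there (here refl))))
    where
    ∉S⇒∉ : ∀ {w p q} → w ∉ S → p ∈ S → q ∈ S → w ∉ p ∷ q ∷ []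
    ∉S⇒∉ w∉ p∈ q∈ (here refl)         = w∉ p∈
    ∉S⇒∉ w∉ p∈ q∈ (there (here refl)) = w∉ q∈
    outsideBoth : ∀ {p q} → p ∈ S → q ∈ S → Missed G (s ∷ t ∷ S) p q
    outsideBoth p∈ q∈ = s , t , here refl , there (here refl) , s≢t , ¬st , ∉S⇒∉ s∉ p∈ q∈ , ∉S⇒∉ t∉ p∈ q∈

-- Five vertices and the pentagon

does-⇔ : {A B : Set} (A? : Dec A) (B? : Dec B) → does A? ≡ does B? → A ⇔ B
does-⇔ (yes a) (yes b) _ = mk⇔ (λ _ → b) (λ _ → a)
does-⇔ (no ¬a) (no ¬b) _ = mk⇔ (⊥-elim ∘ ¬a) (⊥-elim ∘ ¬b)

i₀ : e ∈ e ∷ es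
i₀ = here refl

i₁ : e ∈ e₁ ∷ e ∷ es
i₁ = there i₀

i₂ : e ∈ e₁ ∷ e₂ ∷ e ∷ es
i₂ = there i₁

i₃ : e ∈ e₁ ∷ e₂ ∷ e₃ ∷ e ∷ es
i₃ = there i₂

i₄ : e ∈ e₁ ∷ e₂ ∷ e₃ ∷ e₄ ∷ e ∷ es
i₄ = there i₃

module _ (G : Graph n) {v₀ v₁ v₂ v₃ v₄ : Fin n} where

  -- The ten given adjacencies and nonadjacencies fix the whole table, which evaluation then
  -- compares with `C₅`.
  pentagon⇒≅C₅ : let xs = v₀ ∷ v₁ ∷ v₂ ∷ v₃ ∷ v₄ ∷ [] in
    Unique xs → (∀ v → v ∈ xs) →
    Adj G v₀ v₁ → Adj G v₁ v₂ → Adj G v₂ v₃ → Adj G v₃ v₄ → Adj G v₀ v₄ →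
    ¬ Adj G v₀ v₂ → ¬ Adj G v₀ v₃ → ¬ Adj G v₁ v₃ → ¬ Adj G v₁ v₄ → ¬ Adj G v₂ v₄ → G ≅ C₅
  pentagon⇒≅C₅ unique all a₀₁ a₁₂ a₂₃ a₃₄ a₀₄ b₀₂ b₀₃ b₁₃ b₁₄ b₂₄ = record
    { bijection = mk↔ₛ′ (index ∘ all) (List.lookup xs)
        (λ i → lookup-injective unique (sym (lookup-index (all (List.lookup xs i)))))
        (λ v → sym (lookup-index (all v)))
    ; adjacency = λ u v → subst₂ (λ u′ v′ → Adj G u′ v′ ⇔ Adj C₅ (index (all u)) (index (all v)))
        (sym (lookup-index (all u))) (sym (lookup-index (all v)))
        (does-⇔ (adj? G _ _) (adj? C₅ _ _) (entries (index (all u)) (index (all v))))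
    }
    where
    xs = v₀ ∷ v₁ ∷ v₂ ∷ v₃ ∷ v₄ ∷ []

    cycle : Table 5
    cycle = (true ∷ false ∷ false ∷ true ∷ []) , (true ∷ false ∷ false ∷ []) ,
            (true ∷ false ∷ []) , (true ∷ []) , [] , tt

    adjTable≡cycle : adjTable G xs ≡ cycle
    adjTable≡cycle
      rewrite dec-true (adj? G v₀ v₁) a₀₁ | dec-true (adj? G v₁ v₂) a₁₂
            | dec-true (adj? G v₂ v₃) a₂₃ | dec-true (adj? G v₃ v₄) a₃₄
            | dec-true (adj? G v₀ v₄) a₀₄ | dec-false (adj? G v₀ v₂) b₀₂
            | dec-false (adj? G v₀ v₃) b₀₃ | dec-false (adj? G v₁ v₃) b₁₃
            | dec-false (adj? G v₁ v₄) b₁₄ | dec-false (adj? G v₂ v₄) b₂₄ = refl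

    entries : ∀ i j → adjMatrix G xs i j ≡ does (adj? C₅ i j)
    entries i j = trans (sym (⟦adjTable⟧ G xs i j)) (trans (cong (λ t → ⟦ t ⟧ i j) adjTable≡cycle)
      (from-yes (all? λ i → all? λ j → ⟦ cycle ⟧ i j Bool.≟ does (adj? C₅ i j)) i j))

module Diameter2 (G : Graph n) (conn : Connected G) (5≤n : 5 ≤ n) (avoiding : Avoiding G)
  (bad : ∀ U → Metric.Spread G conn U → List.length U ≢ 4) where

  open Metric G conn
  open Extremal G conn avoiding bad

  common : ∀ {p q} → p ≢ q → ¬ Adj G p q → ∃ λ z → Adj G p z × Adj G q z
  common {p} {q} p≢q ¬pq with d p q in eq | dist≤2 p q
  ... | 0 | _ = contradiction (dist≡0⇒≡ eq) p≢q
  ... | 1 | _ = contradiction (dist≡1⇒adj eq) ¬pq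
  ... | suc (suc (suc _)) | s≤s (s≤s ())
  ... | 2 | _ with dist-pred eq
  ...   | z , pz , eq′ = z , pz , adj-sym G (dist≡1⇒adj eq′)

  record Sharp (Shape : Set) : Set where
    constructor sharp
    field
      dim+3≤n : dimₗ G conn + 3 ≤ n
      shape   : Shape

  module Frame {x y a b : Fin n} (x≢y : x ≢ y) (¬xy : ¬ Adj G x y) (a≢b : a ≢ b)
    (¬ab : ¬ Adj G a b) (xa : Adj G x a) (xb : Adj G x b) where

    y≢a : y ≢ a
    y≢a refl = ¬xy xa

    y≢b : y ≢ b
    y≢b refl = ¬xy xb

    unique₄ : Unique (x ∷ y ∷ a ∷ b ∷ [])
    unique₄ = (x≢y ∷ adj⇒≢ xa ∷ adj⇒≢ xb ∷ []) ∷ (y≢a ∷ y≢b ∷ []) ∷ (a≢b ∷ []) ∷ [] ∷ []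

    opaque
      n≤5 : n ≤ 5
      n≤5 = decidable-stable (n ≤? 5) λ n≰5 →
        absurd {≰⇒> n≰5} (TwoPairs.thickened G avoiding (≰⇒> n≰5) unique₄)
        where
        absurd : ∀ {6≤n} → ¬ TwoPairs.Thickened G avoiding 6≤n unique₄
        absurd (s , t , (s∉ , t∉ , s≢t) , m₁ , m₂ , m₃ , m₄)
          with thick⇒spread G conn common
            ((s≢t ∷ ¬Any⇒All¬ _ s∉) ∷ ¬Any⇒All¬ _ t∉ ∷ unique₄) ¬xy ¬ab xa xb m₁ m₂ m₃ m₄
        ... | U , spread , len = bad U spread len

    module Fifth {c : Fin n} (c∉ : c ∉ x ∷ y ∷ a ∷ b ∷ []) where

      base : List (Fin n)
      base = c ∷ x ∷ y ∷ a ∷ b ∷ []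

      unique₅ : Unique base
      unique₅ = ¬Any⇒All¬ _ c∉ ∷ unique₄

      all : ∀ v → v ∈ base
      all v = decidable-stable (v ∈? base) λ v∉ →
        <⇒≱ (s≤s n≤5) (unique⇒length≤ (¬Any⇒All¬ _ v∉ ∷ unique₅))

      every : {P : Fin n → Set} → P c → P x → P y → P a → P b → ∀ v → P v
      every {P} pc px py pa pb v =
        All.lookup {P = P} (pc ∷ px ∷ py ∷ pa ∷ pb ∷ []) (all v)

      listed : ∀ {L} → c ∈ L → x ∈ L → y ∈ L → a ∈ L → b ∈ L → ∀ v → v ∈ L
      listed {L} = every {_∈ L}

      -- Some nonadjacent pair avoids `p` and `q`, hence lies among the other three vertices.
      triangle-free : ∀ {p q r₁ r₂ r₃} → (∀ v → v ∈ p ∷ q ∷ r₁ ∷ r₂ ∷ r₃ ∷ []) →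
                      Adj G r₁ r₂ → Adj G r₁ r₃ → ¬ Adj G r₂ r₃
      triangle-free {p} {q} {r₁} {r₂} {r₃} all r₁₂ r₁₃ r₂₃ with avoiding p q
      ... | s , t , s∉ , t∉ , s≢t , ¬st = go (all s) (all t)
        where
        L = p ∷ q ∷ r₁ ∷ r₂ ∷ r₃ ∷ []
        rest : ∀ {w} → w ∉ p ∷ q ∷ [] → w ∈ L → w ∈ r₁ ∷ r₂ ∷ r₃ ∷ []
        rest w∉ (here eq)          = contradiction (here eq) w∉
        rest w∉ (there (here eq))  = contradiction (there (here eq)) w∉
        rest w∉ (there (there w∈)) = w∈
        triangle : ∀ {u v} → u ∈ r₁ ∷ r₂ ∷ r₃ ∷ [] → v ∈ r₁ ∷ r₂ ∷ r₃ ∷ [] → u ≢ v → Adj G u v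
        triangle (here refl)                 (here refl)                 u≢v = contradiction refl u≢v
        triangle (here refl)                 (there (here refl))         _   = r₁₂
        triangle (here refl)                 (there (there (here refl))) _   = r₁₃
        triangle (there (here refl))         (here refl)                 _   = adj-sym G r₁₂
        triangle (there (here refl))         (there (here refl))         u≢v = contradiction refl u≢v
        triangle (there (here refl))         (there (there (here refl))) _   = r₂₃
        triangle (there (there (here refl))) (here refl)                 _   = adj-sym G r₁₃
        triangle (there (there (here refl))) (there (here refl))         _   = adj-sym G r₂₃
        triangle (there (there (here refl))) (there (there (here refl))) u≢v = contradiction refl u≢v
        go : s ∈ L → t ∈ L → ⊥
        go s∈ t∈ = ¬st (triangle (rest s∉ s∈) (rest t∉ t∈) s≢t)

      x≢c : x ≢ c
      x≢c refl = c∉ (here refl)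
      y≢c : y ≢ c
      y≢c refl = c∉ (there (here refl))
      a≢c : a ≢ c
      a≢c refl = c∉ (there (there (here refl)))
      b≢c : b ≢ c
      b≢c refl = c∉ (there (there (there (here refl))))

      x∉ : x ∉ a ∷ b ∷ c ∷ y ∷ []
      x∉ = ∉₄ (adj⇒≢ xa) (adj⇒≢ xb) x≢c x≢y

      x-separates : ∀ {u v} → Adj G x u → ¬ Adj G x v → Sep≢ (a ∷ b ∷ c ∷ y ∷ []) u v
      x-separates xu ¬xv = (λ { refl → ¬xv xu }) , sepˡ x∉ (adj-sym G xu) (¬xv ∘ adj-sym G)

      -- If `x` were adjacent to `c`, then `a`, `b`, `c` would be independent by `triangle-free`,
      -- and `x` would separate each of them from `y`.
      ¬xc : ¬ Adj G x c
      ¬xc xc = bad₄ (a≢b , inj₁ ¬ab) (a≢c , inj₁ ¬ac) (x-separates xa ¬xy)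
                    (b≢c , inj₁ ¬bc) (x-separates xb ¬xy) (x-separates xc ¬xy)
        where
        ¬ac : ¬ Adj G a c
        ¬ac = triangle-free {y} {b} (listed i₄ i₂ i₀ i₃ i₁) xa xc
        ¬bc : ¬ Adj G b c
        ¬bc = triangle-free {y} {a} (listed i₄ i₂ i₀ i₁ i₃) xb xc

      -- Since `x` separates `a` and `b` from `c` and `y`, nonadjacency of `y` and `c` would make
      -- these four vertices spread.
      yc : Adj G y c
      yc = decidable-stable (adj? G y c) λ ¬yc →
        bad₄ (a≢b , inj₁ ¬ab) (x-separates xa ¬xc) (x-separates xa ¬xy)
             (x-separates xb ¬xc) (x-separates xb ¬xy) (≢-sym y≢c , inj₁ (¬yc ∘ adj-sym G))

      conclude : ∀ {v₀ v₁ v₂ v₃ v₄} (let xs = v₀ ∷ v₁ ∷ v₂ ∷ v₃ ∷ v₄ ∷ []) →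
        Unique xs → (∀ v → v ∈ xs) →
        Adj G v₀ v₁ → Adj G v₁ v₂ → Adj G v₂ v₃ → Adj G v₃ v₄ → Adj G v₀ v₄ →
        ¬ Adj G v₀ v₂ → ¬ Adj G v₀ v₃ → ¬ Adj G v₁ v₃ → ¬ Adj G v₁ v₄ → ¬ Adj G v₂ v₄ → Sharp (G ≅ C₅)
      conclude {v₀} {v₁} {v₂} {v₃} {v₄} unique all a₀₁ a₁₂ a₂₃ a₃₄ a₀₄ b₀₂ b₀₃ b₁₃ b₁₄ b₂₄ =
        -- Three consecutive vertices of the cycle are spread: `v₄` separates the first edge and
        -- `v₃` the second.
        sharp (spread⇒dim+length≤ {v₀ ∷ v₁ ∷ v₂ ∷ []}
          (((adj⇒≢ a₀₁ , sepˡ v₄∉ a₀₄ b₁₄) ∷ (v₀≢v₂ , inj₁ b₀₂) ∷ [])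
            ∷ ((adj⇒≢ a₁₂ , sepʳ v₃∉ b₁₃ a₂₃) ∷ []) ∷ [] ∷ []))
        (pentagon⇒≅C₅ G unique all a₀₁ a₁₂ a₂₃ a₃₄ a₀₄ b₀₂ b₀₃ b₁₃ b₁₄ b₂₄)
        where
        v₀≢v₂ : v₀ ≢ v₂
        v₀≢v₂ refl = b₀₃ a₂₃
        v₃∉ : v₃ ∉ v₀ ∷ v₁ ∷ v₂ ∷ []
        v₃∉ = All¬⇒¬Any
          ((λ { refl → b₀₂ (adj-sym G a₂₃) }) ∷ (λ { refl → b₀₃ a₀₁ }) ∷ ≢-sym (adj⇒≢ a₂₃) ∷ [])
        v₄∉ : v₄ ∉ v₀ ∷ v₁ ∷ v₂ ∷ []
        v₄∉ = All¬⇒¬Any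
          (≢-sym (adj⇒≢ a₀₄) ∷ (λ { refl → b₁₃ (adj-sym G a₃₄) }) ∷ (λ { refl → b₀₂ a₀₄ }) ∷ [])

      x-neighbour : ∀ v → Adj G x v → v ≡ a ⊎ v ≡ b
      x-neighbour = every {λ v → Adj G x v → v ≡ a ⊎ v ≡ b}
                          (⊥-elim ∘ ¬xc) (⊥-elim ∘ adj-irr G refl) (⊥-elim ∘ ¬xy)
                          (λ _ → inj₁ refl) (λ _ → inj₂ refl)

      ¬yca : Adj G y a → ¬ Adj G c a
      ¬yca = triangle-free {x} {b} (listed i₃ i₀ i₂ i₄ i₁) yc

      ¬ycb : Adj G y b → ¬ Adj G c b
      ¬ycb = triangle-free {x} {a} (listed i₃ i₀ i₂ i₁ i₄) yc

      -- The common neighbours of `x`, `y` and of `x`, `c` lie in `a`, `b`. They are distinct, since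
      -- one vertex serving both would form a triangle with the edge `yc`; this closes the
      -- five-cycle.
      pentagon : Sharp (G ≅ C₅)
      pentagon with common x≢y ¬xy | common x≢c ¬xc
      ... | z , xz , yz | w , xw , cw with x-neighbour z xz | x-neighbour w xw
      ... | inj₁ refl | inj₁ refl = contradiction cw (¬yca yz)
      ... | inj₂ refl | inj₂ refl = contradiction cw (¬ycb yz)
      ... | inj₁ refl | inj₂ refl = conclude {x} {a} {y} {c} {b}
        ((adj⇒≢ xa ∷ x≢y ∷ x≢c ∷ adj⇒≢ xb ∷ []) ∷ (≢-sym y≢a ∷ a≢c ∷ a≢b ∷ [])
          ∷ (y≢c ∷ y≢b ∷ []) ∷ (≢-sym b≢c ∷ []) ∷ [] ∷ [])
        (listed i₃ i₀ i₂ i₁ i₄) xa (adj-sym G yz) yc cw xb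
        ¬xy ¬xc (¬yca yz ∘ adj-sym G) ¬ab (λ yb → ¬ycb yb cw)
      ... | inj₂ refl | inj₁ refl = conclude {x} {b} {y} {c} {a}
        ((adj⇒≢ xb ∷ x≢y ∷ x≢c ∷ adj⇒≢ xa ∷ []) ∷ (≢-sym y≢b ∷ b≢c ∷ ≢-sym a≢b ∷ [])
          ∷ (y≢c ∷ y≢a ∷ []) ∷ (≢-sym a≢c ∷ []) ∷ [] ∷ [])
        (listed i₃ i₀ i₂ i₄ i₁) xb (adj-sym G yz) yc cw xa
        ¬xy ¬xc (¬ycb yz ∘ adj-sym G) (¬ab ∘ adj-sym G) (λ ya → ¬yca ya cw)

    pentagon : Sharp (G ≅ C₅)
    pentagon with fresh (x ∷ y ∷ a ∷ b ∷ []) 5≤n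
    ... | c , c∉ = Fifth.pentagon c∉

-- Recognising K⁻

left? : ∀ {A B : Set} → A ⊎ B → Bool
left? (inj₁ _) = true
left? (inj₂ _) = false

↔-injective : {A B : Set} (φ : A ↔ B) → ∀ {x y} → Inverse.to φ x ≡ Inverse.to φ y → x ≡ y
↔-injective φ eq = trans (sym (strictlyInverseʳ _)) (trans (cong from eq) (strictlyInverseʳ _))
  where open Inverse φ

cons↔ : {B : Set} → Fin n ↔ (Fin k ⊎ B) → Fin (suc n) ↔ (Fin (suc k) ⊎ B)
cons↔ {n} {k} {B} φ = mk↔ₛ′ to′ from′ to∘from from∘to
  where
  open Inverse φ
  to′ : Fin (suc n) → Fin (suc k) ⊎ B
  to′ zero    = inj₁ zero
  to′ (suc v) = Sum.map₁ suc (to v)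
  from′ : Fin (suc k) ⊎ B → Fin (suc n)
  from′ (inj₁ zero)    = zero
  from′ (inj₁ (suc i)) = suc (from (inj₁ i))
  from′ (inj₂ j)       = suc (from (inj₂ j))
  to∘from : ∀ b → to′ (from′ b) ≡ b
  to∘from (inj₁ zero)    = refl
  to∘from (inj₁ (suc i)) = cong (Sum.map₁ suc) (strictlyInverseˡ (inj₁ i))
  to∘from (inj₂ j)       = cong (Sum.map₁ suc) (strictlyInverseˡ (inj₂ j))
  from∘map : ∀ b → from′ (Sum.map₁ suc b) ≡ suc (from b)
  from∘map (inj₁ i) = refl
  from∘map (inj₂ j) = refl
  from∘to : ∀ v → from′ (to′ v) ≡ v
  from∘to zero    = refl
  from∘to (suc v) = trans (from∘map (to v)) (cong suc (strictlyInverseʳ v))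

-- Numbers the two sides of a Boolean split separately; applied twice, it produces the three blocks
-- of `K⁻`.
partition : (f : Fin n → Bool) →
  ∃₂ λ k r → Σ (Fin n ↔ (Fin k ⊎ Fin r)) λ φ → ∀ v → left? (Inverse.to φ v) ≡ f v
partition {zero}  f =
  0 , 0 , mk↔ₛ′ (λ ()) Sum.reduce (λ { (inj₁ ()) ; (inj₂ ()) }) (λ ()) , λ ()
partition {suc n} f with partition (f ∘ suc)
... | k , r , φ , sides with f zero in f0
... | true  = suc k , r , cons↔ φ , λ
  { zero    → sym f0
  ; (suc v) → trans (left?-map₁ (Inverse.to φ v)) (sides v) }
  where
  left?-map₁ : ∀ b → left? (Sum.map₁ suc b) ≡ left? b
  left?-map₁ (inj₁ _) = refl
  left?-map₁ (inj₂ _) = refl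
-- Conjugating `cons↔` by the exchange of summands puts the new element on the second side.
... | false = k , suc r , ⊎-comm _ _ ↔-∘ cons↔ (⊎-comm _ _ ↔-∘ φ) , λ
  { zero    → sym f0
  ; (suc v) → trans (left?-swap (Inverse.to φ v)) (sides v) }
  where
  left?-swap : ∀ b → left? (Sum.swap (Sum.map₁ suc (Sum.swap b))) ≡ left? b
  left?-swap (inj₁ _) = refl
  left?-swap (inj₂ _) = refl

-- The two parts of the deleted bipartite graph, followed by the universal vertices.
Blocks : ℕ → ℕ → ℕ → Set
Blocks l m r = (Fin l ⊎ Fin m) ⊎ Fin r

Opposite : Blocks l m r → Blocks l m r → Set
Opposite (inj₁ a) (inj₁ b) = left? a ≢ left? b
Opposite _        _        = ⊥

-- Lists the blocks consecutively, in the numbering that `K⁻` uses.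
place : ∀ l m r → Blocks l m r ↔ Fin (l + m + r)
place l m r = ↔-sym +↔⊎ ↔-∘ (↔-sym +↔⊎ ⊎-↔ ↔-id _)

InBlock : Blocks l m r → Fin (l + m + r) → Set
InBlock {l} {m} (inj₁ (inj₁ _)) i = toℕ i < l
InBlock {l} {m} (inj₁ (inj₂ _)) i = l ≤ toℕ i × toℕ i < l + m
InBlock {l} {m} (inj₂ _)        i = l + m ≤ toℕ i

inBlock : (b : Blocks l m r) → InBlock b (Inverse.to (place l m r) b)
inBlock {l} {m} {r} (inj₁ (inj₁ i))
  rewrite toℕ-↑ˡ (i ↑ˡ m) r | toℕ-↑ˡ i m = toℕ<n i
inBlock {l} {m} {r} (inj₁ (inj₂ j))
  rewrite toℕ-↑ˡ (l ↑ʳ j) r | toℕ-↑ʳ l j = m≤m+n l (toℕ j) , +-monoʳ-< l (toℕ<n j)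
inBlock {l} {m} {r} (inj₂ k) rewrite toℕ-↑ʳ (l + m) k = m≤m+n (l + m) (toℕ k)

module _ (G : Graph n) where

  BlockForm : ∀ {l m r} → (Fin n ↔ Blocks l m r) → Set
  BlockForm φ = ∀ u v → Adj G u v ⇔ (u ≢ v × ¬ Opposite (Inverse.to φ u) (Inverse.to φ v))

  blockForm⇒≅K⁻ : (φ : Fin n ↔ Blocks l m r) → BlockForm φ → G ≅ K⁻ n l m
  blockForm⇒≅K⁻ {l} {m} {r} φ form with ↔⇒≡ (place l m r ↔-∘ φ)
  ... | refl = record { bijection = ψ ; adjacency = λ u v → mk⇔
      (λ a → let u≢v , ¬opp = to (form u v) a in u≢v ∘ ↔-injective ψ , ¬opp ∘ opposite u v)
      (λ (ψ≢ , ¬del) → from (form u v) (ψ≢ ∘ cong (Inverse.to ψ) , ¬del ∘ deleted u v)) }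
    where
    open Equivalence
    ψ : Fin n ↔ Fin n
    ψ = place l m r ↔-∘ φ
    Deleted : Fin n → Fin n → Set
    Deleted i j = toℕ i < l × (l ≤ toℕ j × toℕ j < l + m)
    fromLeft : ∀ {i} (b : Blocks l m r) → InBlock b i → toℕ i < l → ∃ λ a → b ≡ inj₁ (inj₁ a)
    fromLeft (inj₁ (inj₁ a)) _        _  = a , refl
    fromLeft (inj₁ (inj₂ _)) (ge , _) lt = contradiction ge (<⇒≱ lt)
    fromLeft (inj₂ _)        ge       lt = contradiction (≤-trans (m≤m+n l m) ge) (<⇒≱ lt)
    fromRight : ∀ {i} (b : Blocks l m r) → InBlock b i → l ≤ toℕ i × toℕ i < l + m →
                ∃ λ a → b ≡ inj₁ (inj₂ a)
    fromRight (inj₁ (inj₁ _)) lt (ge , _) = contradiction ge (<⇒≱ lt)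
    fromRight (inj₁ (inj₂ a)) _  _        = a , refl
    fromRight (inj₂ _)        ge (_ , lt) = contradiction ge (<⇒≱ lt)
    opposite : ∀ u v →
               Deleted (Inverse.to ψ u) (Inverse.to ψ v) ⊎ Deleted (Inverse.to ψ v) (Inverse.to ψ u) →
               Opposite (Inverse.to φ u) (Inverse.to φ v)
    opposite u v = [ go , swapped ]′
      where
      go : Deleted (Inverse.to ψ u) (Inverse.to ψ v) → Opposite (Inverse.to φ u) (Inverse.to φ v)
      go (lt , between)
        with fromLeft (Inverse.to φ u) (inBlock (Inverse.to φ u)) lt
           | fromRight (Inverse.to φ v) (inBlock (Inverse.to φ v)) between
      ... | _ , eq | _ , eq′ = subst₂ Opposite (sym eq) (sym eq′) λ ()
      swapped : Deleted (Inverse.to ψ v) (Inverse.to ψ u) → Opposite (Inverse.to φ u) (Inverse.to φ v)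
      swapped (lt , between)
        with fromLeft (Inverse.to φ v) (inBlock (Inverse.to φ v)) lt
           | fromRight (Inverse.to φ u) (inBlock (Inverse.to φ u)) between
      ... | _ , eq | _ , eq′ = subst₂ Opposite (sym eq′) (sym eq) λ ()
    deleted′ : ∀ {i j} (b b′ : Blocks l m r) → InBlock b i → InBlock b′ j → Opposite b b′ →
               Deleted i j ⊎ Deleted j i
    deleted′ (inj₁ (inj₁ _)) (inj₁ (inj₁ _)) _  _  opp = contradiction refl opp
    deleted′ (inj₁ (inj₁ _)) (inj₁ (inj₂ _)) i∈ j∈ _   = inj₁ (i∈ , j∈)
    deleted′ (inj₁ (inj₂ _)) (inj₁ (inj₁ _)) i∈ j∈ _   = inj₂ (j∈ , i∈)
    deleted′ (inj₁ (inj₂ _)) (inj₁ (inj₂ _)) _  _  opp = contradiction refl opp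
    deleted′ (inj₁ _)        (inj₂ _)        _  _  ()
    deleted′ (inj₂ _)        _               _  _  ()
    deleted : ∀ u v → Opposite (Inverse.to φ u) (Inverse.to φ v) →
              Deleted (Inverse.to ψ u) (Inverse.to ψ v) ⊎ Deleted (Inverse.to ψ v) (Inverse.to ψ u)
    deleted u v = deleted′ (Inverse.to φ u) (Inverse.to φ v)
      (inBlock (Inverse.to φ u)) (inBlock (Inverse.to φ v))

  -- If the second part is the larger one, the two parts are exchanged to obtain `m ≤ l`.
  blockForm⇒K⁻ : (φ : Fin n ↔ Blocks l m r) → BlockForm φ → 2 ≤ l → 2 ≤ m → 0 < r →
    ∃₂ λ l m → m ≤ l × 2 ≤ m × l + m < n × G ≅ K⁻ n l m
  blockForm⇒K⁻ {l} {m} {r} φ form 2≤l 2≤m 0<r with ≤-total m l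
  ... | inj₁ m≤l = l , m , m≤l , 2≤m , l+m<n , blockForm⇒≅K⁻ φ form
    where
    l+m<n : l + m < n
    l+m<n = ≤-trans (m<m+n (l + m) 0<r) (≤-reflexive (sym (↔⇒≡ (place l m r ↔-∘ φ))))
  ... | inj₂ l≤m = m , l , l≤m , 2≤l , m+l<n , blockForm⇒≅K⁻ φ′ form′
    where
    φ′ : Fin n ↔ Blocks m l r
    φ′ = (⊎-comm _ _ ⊎-↔ ↔-id _) ↔-∘ φ
    m+l<n : m + l < n
    m+l<n = ≤-trans (m<m+n (m + l) 0<r) (≤-reflexive (sym (↔⇒≡ (place m l r ↔-∘ φ′))))
    flip : Blocks l m r → Blocks m l r
    flip = Sum.map₁ Sum.swap
    opposite-flip : (b b′ : Blocks l m r) → Opposite b b′ ⇔ Opposite (flip b) (flip b′)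
    opposite-flip (inj₁ (inj₁ _)) (inj₁ (inj₁ _)) = mk⇔ (λ p _ → p refl) (λ p _ → p refl)
    opposite-flip (inj₁ (inj₁ _)) (inj₁ (inj₂ _)) = mk⇔ (λ _ ()) (λ _ ())
    opposite-flip (inj₁ (inj₂ _)) (inj₁ (inj₁ _)) = mk⇔ (λ _ ()) (λ _ ())
    opposite-flip (inj₁ (inj₂ _)) (inj₁ (inj₂ _)) = mk⇔ (λ p _ → p refl) (λ p _ → p refl)
    opposite-flip (inj₁ _)        (inj₂ _)        = mk⇔ (λ ()) (λ ())
    opposite-flip (inj₂ _)        _               = mk⇔ (λ ()) (λ ())
    form′ : BlockForm φ′
    form′ u v = mk⇔
      (λ a → let u≢v , ¬opp = to (form u v) a in
        u≢v , ¬opp ∘ from (opposite-flip (Inverse.to φ u) (Inverse.to φ v)))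
      (λ (u≢v , ¬opp) → from (form u v)
        (u≢v , ¬opp ∘ to (opposite-flip (Inverse.to φ u) (Inverse.to φ v))))
      where open Equivalence

≢⇒2≤ : {i j : Fin l} → i ≢ j → 2 ≤ l
≢⇒2≤ {i = zero}  {zero}  i≢j = contradiction refl i≢j
≢⇒2≤ {i = zero}  {suc j} _   = s≤s (≤-trans (s≤s z≤n) (positive j))
  where
  positive : Fin l → 1 ≤ l
  positive zero    = s≤s z≤n
  positive (suc _) = s≤s z≤n
≢⇒2≤ {i = suc i} {zero}  i≢j = ≢⇒2≤ (≢-sym i≢j)
≢⇒2≤ {i = suc i} {suc j} i≢j = s≤s (<⇒≤ (≢⇒2≤ (i≢j ∘ cong suc)))

module Simplicial (G : Graph n) (conn : Connected G) (5≤n : 5 ≤ n) (avoiding : Avoiding G)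
  (bad : ∀ U → Metric.Spread G conn U → List.length U ≢ 4)
  (simplicial : ∀ {x y a b} → x ≢ y → ¬ Adj G x y → a ≢ b → Adj G x a → Adj G x b → Adj G a b)
  where

  open Metric G conn
  open Extremal G conn avoiding bad
  open Diameter2 G conn 5≤n avoiding bad

  Universal : Fin n → Set
  Universal v = ∀ w → v ≢ w → Adj G v w

  universal? : ∀ v → Dec (Universal v)
  universal? v = all? λ w → ¬? (v ≟ w) →-dec adj? G v w

  Near : Fin n → Fin n → Set
  Near p v = v ≡ p ⊎ Adj G v p

  near? : ∀ p v → Dec (Near p v)
  near? p v = (v ≟ p) ⊎-dec adj? G v p

  neighbours-adjacent : ∀ {v a b} → ¬ Universal v → a ≢ b → Adj G v a → Adj G v b → Adj G a b
  neighbours-adjacent {v} ¬univ a≢b va vb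
    with ¬∀⟶∃¬ _ _ (λ w → ¬? (v ≟ w) →-dec adj? G v w) ¬univ
  ... | w , ¬adj = simplicial
    (λ v≡w → ¬adj λ v≢w → contradiction v≡w v≢w) (λ vw → ¬adj λ _ → vw) a≢b va vb

  -- Take a nonadjacent pair avoiding `v` and `w`. Its ends are not both neighbours of `u`, as the
  -- neighbourhood of `u` is a clique; if one end is `u`, the other is the required vertex.
  away : ∀ {u v} w → u ≢ v → ¬ Adj G u v → ∃ λ z → z ∉ v ∷ w ∷ [] × z ≢ u × ¬ Adj G u z
  away {u} {v} w u≢v ¬uv with avoiding v w
  ... | s , t , s∉ , t∉ , s≢t , ¬st with s ≟ u | t ≟ u | adj? G u s | adj? G u t
  ... | yes refl | _        | _     | _      = t , t∉ , ≢-sym s≢t , ¬st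
  ... | no _     | yes refl | _     | _      = s , s∉ , s≢t , ¬st ∘ adj-sym G
  ... | no s≢u   | _        | no ¬us | _     = s , s∉ , s≢u , ¬us
  ... | _        | no t≢u   | _     | no ¬ut = t , t∉ , t≢u , ¬ut
  ... | _        | _        | yes us | yes ut = contradiction (simplicial u≢v ¬uv s≢t us ut) ¬st

  module Two {p q c : Fin n} (p≢q : p ≢ q) (¬pq : ¬ Adj G p q) (pc : Adj G p c) (qc : Adj G q c) where

    ¬qp : ¬ Adj G q p
    ¬qp = ¬pq ∘ adj-sym G

    -- The neighbours `p` and `q` of `c` are nonadjacent, so `simplicial` rules out a nonneighbour
    -- of `c`.
    c-universal : Universal c
    c-universal v c≢v = decidable-stable (adj? G c v) λ ¬cv →
      ¬pq (simplicial c≢v ¬cv p≢q (adj-sym G pc) (adj-sym G qc))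

    -- Supplies a vertex that separates `u` from the universal vertex `c`.
    apart : ∀ {u v} w → u ≢ v → ¬ Adj G u v → Adj G u c →
            ∃ λ z → (z ≢ u × z ≢ v × z ≢ w × z ≢ c) × ¬ Adj G u z × Adj G c z
    apart w u≢v ¬uv uc with away w u≢v ¬uv
    ... | z , z∉ , z≢u , ¬uz =
      z , (z≢u , z∉ ∘ here , z∉ ∘ there ∘ here , z≢c) , ¬uz , c-universal z (≢-sym z≢c)
      where
      z≢c : z ≢ c
      z≢c refl = ¬uz uc

    -- Otherwise `p`, `q`, `v` would be independent, and the vertices from `apart` would separate
    -- each of them from `c`, so that `p`, `q`, `v`, `c` would be spread.
    no-third : ∀ {v} → p ≢ v → q ≢ v → ¬ Adj G p v → ¬ Adj G q v → ⊥
    no-third {v} p≢v q≢v ¬pv ¬qv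
      with apart v p≢q ¬pq pc | apart v (≢-sym p≢q) ¬qp qc | apart q (≢-sym p≢v) (¬pv ∘ adj-sym G) vc
      where
      vc : Adj G v c
      vc = adj-sym G (c-universal v λ { refl → ¬pv pc })
    ... | z₁ , (z₁≢p , z₁≢q , z₁≢v , z₁≢c) , ¬pz₁ , cz₁
        | z₂ , (z₂≢q , z₂≢p , z₂≢v , z₂≢c) , ¬qz₂ , cz₂
        | z₃ , (z₃≢v , z₃≢p , z₃≢q , z₃≢c) , ¬vz₃ , cz₃ = bad₄
      (p≢q , inj₁ ¬pq) (p≢v , inj₁ ¬pv) (adj⇒≢ pc , sepʳ (∉₄ z₁≢p z₁≢q z₁≢v z₁≢c) ¬pz₁ cz₁)
      (q≢v , inj₁ ¬qv) (adj⇒≢ qc , sepʳ (∉₄ z₂≢p z₂≢q z₂≢v z₂≢c) ¬qz₂ cz₂)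
      ((λ { refl → ¬pv pc }) , sepʳ (∉₄ z₃≢p z₃≢q z₃≢v z₃≢c) ¬vz₃ cz₃)

    near : ∀ v → Near p v ⊎ Near q v
    near v with near? p v | near? q v
    ... | yes nearp | _         = inj₁ nearp
    ... | _         | yes nearq = inj₂ nearq
    ... | no ¬nearp | no ¬nearq = contradiction (¬nearq ∘ inj₂ ∘ adj-sym G)
      (no-third (¬nearp ∘ inj₁ ∘ sym) (¬nearq ∘ inj₁ ∘ sym) (¬nearp ∘ inj₂ ∘ adj-sym G))

    near-disjoint : ∀ {v} → ¬ Universal v → Near p v → ¬ Near q v
    near-disjoint _     (inj₁ refl) (inj₁ p≡q)  = p≢q p≡q
    near-disjoint _     (inj₁ refl) (inj₂ pq)   = ¬pq pq
    near-disjoint _     (inj₂ qp)   (inj₁ refl) = ¬qp qp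
    near-disjoint ¬univ (inj₂ vp)   (inj₂ vq)   = ¬pq (neighbours-adjacent ¬univ p≢q vp vq)

    near-clique : ∀ {e u v} → ¬ Universal e → Near e u → Near e v → u ≢ v → Adj G u v
    near-clique _     (inj₁ refl) (inj₁ refl) u≢v = contradiction refl u≢v
    near-clique _     (inj₁ refl) (inj₂ ve)   _   = adj-sym G ve
    near-clique _     (inj₂ ue)   (inj₁ refl) _   = ue
    near-clique ¬univ (inj₂ ue)   (inj₂ ve)   u≢v =
      neighbours-adjacent ¬univ u≢v (adj-sym G ue) (adj-sym G ve)

    ¬univ-p : ¬ Universal p
    ¬univ-p univ = ¬pq (univ q p≢q)

    ¬univ-q : ¬ Universal q
    ¬univ-q univ = ¬qp (univ p (≢-sym p≢q))

    -- An edge between `u` and `v` would put `v` near `p` as well as near `q`.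
    near-apart : ∀ {u v} → ¬ Universal u → ¬ Universal v → Near p u → Near q v → ¬ Adj G u v
    near-apart {u} {v} ¬u ¬v nu nv uv with v ≟ p | nu
    ... | yes refl | _         = near-disjoint ¬v (inj₁ refl) nv
    ... | no _     | inj₁ refl = near-disjoint ¬v (inj₂ (adj-sym G uv)) nv
    ... | no v≢p   | inj₂ up   = near-disjoint ¬v (inj₂ (neighbours-adjacent ¬u v≢p uv up)) nv

    data Class {l m r} (v : Fin n) : Blocks l m r → Set where
      atP : ∀ {i} → ¬ Universal v → Near p v → Class v (inj₁ (inj₁ i))
      atQ : ∀ {i} → ¬ Universal v → Near q v → Class v (inj₁ (inj₂ i))
      top : ∀ {i} → Universal v → Class v (inj₂ i)

    module Classified (φ : Fin n ↔ Blocks l m r) (class : ∀ v → Class v (Inverse.to φ v)) where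

      open Inverse φ using (to)

      adjacent⇔ : ∀ {u v} {b b′ : Blocks l m r} → Class u b → Class v b′ →
                  Adj G u v ⇔ (u ≢ v × ¬ Opposite b b′)
      adjacent⇔ (atP ¬u nu) (atP ¬v nv) =
        mk⇔ (λ uv → adj⇒≢ uv , λ opp → opp refl) (λ (u≢v , _) → near-clique ¬univ-p nu nv u≢v)
      adjacent⇔ (atP ¬u nu) (atQ ¬v nv) =
        mk⇔ (⊥-elim ∘ near-apart ¬u ¬v nu nv) (λ (_ , ¬opp) → contradiction (λ ()) ¬opp)
      adjacent⇔ (atQ ¬u nu) (atP ¬v nv) =
        mk⇔ (⊥-elim ∘ near-apart ¬v ¬u nv nu ∘ adj-sym G) (λ (_ , ¬opp) → contradiction (λ ()) ¬opp)
      adjacent⇔ (atQ ¬u nu) (atQ ¬v nv) =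
        mk⇔ (λ uv → adj⇒≢ uv , λ opp → opp refl) (λ (u≢v , _) → near-clique ¬univ-q nu nv u≢v)
      adjacent⇔ {v = v} (top univ) _     = mk⇔ (λ uv → adj⇒≢ uv , λ ()) (λ (u≢v , _) → univ v u≢v)
      adjacent⇔ {u} (atP _ _) (top univ) =
        mk⇔ (λ uv → adj⇒≢ uv , λ ()) (λ (u≢v , _) → adj-sym G (univ u (≢-sym u≢v)))
      adjacent⇔ {u} (atQ _ _) (top univ) =
        mk⇔ (λ uv → adj⇒≢ uv , λ ()) (λ (u≢v , _) → adj-sym G (univ u (≢-sym u≢v)))

      blockForm : BlockForm G φ
      blockForm u v = adjacent⇔ (class u) (class v)

      inP : ∀ {v} → ¬ Universal v → Near p v → ∃ λ i → to v ≡ inj₁ (inj₁ i)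
      inP {v} ¬univ nearp with to v | class v
      ... | _ | atP _ _     = _ , refl
      ... | _ | atQ _ nearq = contradiction nearq (near-disjoint ¬univ nearp)
      ... | _ | top univ    = contradiction univ ¬univ

      inQ : ∀ {v} → ¬ Universal v → Near q v → ∃ λ i → to v ≡ inj₁ (inj₂ i)
      inQ {v} ¬univ nearq with to v | class v
      ... | _ | atP _ nearp = contradiction nearq (near-disjoint ¬univ nearp)
      ... | _ | atQ _ _     = _ , refl
      ... | _ | top univ    = contradiction univ ¬univ

      0<r : 0 < r
      0<r with to c | class c
      ... | _ | atP ¬univ _        = contradiction c-universal ¬univ
      ... | _ | atQ ¬univ _        = contradiction c-universal ¬univ
      ... | _ | top {zero} _       = s≤s z≤n
      ... | _ | top {suc i} _      = s≤s z≤n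

      -- Besides `p`, the vertex `q` has a second nonneighbour by `away`, and this vertex lies in
      -- the block of `p`.
      2≤l : 2 ≤ l
      2≤l with away q (≢-sym p≢q) ¬qp
      ... | z , z∉ , z≢q , ¬qz with near z
      ...   | inj₂ (inj₁ z≡q) = contradiction z≡q z≢q
      ...   | inj₂ (inj₂ zq)  = contradiction (adj-sym G zq) ¬qz
      ...   | inj₁ nearp with inP ¬univ-p (inj₁ refl) | inP (λ univ → ¬qz (adj-sym G (univ q z≢q))) nearp
      ...     | i , eq | j , eq′ = ≢⇒2≤ {i = j} {i} λ { refl →
        z∉ (here (↔-injective φ (trans eq′ (sym eq)))) }

      2≤m : 2 ≤ m
      2≤m with away p p≢q ¬pq
      ... | z , z∉ , z≢p , ¬pz with near z
      ...   | inj₁ (inj₁ z≡p) = contradiction z≡p z≢p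
      ...   | inj₁ (inj₂ zp)  = contradiction (adj-sym G zp) ¬pz
      ...   | inj₂ nearq with inQ ¬univ-q (inj₁ refl) | inQ (λ univ → ¬pz (adj-sym G (univ p z≢p))) nearq
      ...     | i , eq | j , eq′ = ≢⇒2≤ {i = j} {i} λ { refl →
        z∉ (here (↔-injective φ (trans eq′ (sym eq)))) }

      shape : ∃₂ λ l m → m ≤ l × 2 ≤ m × l + m < n × G ≅ K⁻ n l m
      shape = blockForm⇒K⁻ G φ blockForm 2≤l 2≤m 0<r

    -- The set `p`, `q`, `c` is spread, with second nonneighbours of `p` and `q` separating them
    -- from `c`.
    dim+3≤n : dimₗ G conn + 3 ≤ n
    dim+3≤n with apart q p≢q ¬pq pc | apart p (≢-sym p≢q) ¬qp qc
    ... | z₁ , (z₁≢p , z₁≢q , _ , z₁≢c) , ¬pz₁ , cz₁ | z₂ , (z₂≢q , z₂≢p , _ , z₂≢c) , ¬qz₂ , cz₂ =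
      spread⇒dim+length≤ {p ∷ q ∷ c ∷ []}
        (((p≢q , inj₁ ¬pq) ∷ (adj⇒≢ pc , sepʳ (All¬⇒¬Any (z₁≢p ∷ z₁≢q ∷ z₁≢c ∷ [])) ¬pz₁ cz₁) ∷ [])
          ∷ ((adj⇒≢ qc , sepʳ (All¬⇒¬Any (z₂≢p ∷ z₂≢q ∷ z₂≢c ∷ [])) ¬qz₂ cz₂) ∷ []) ∷ [] ∷ [])

    K⁻-shaped : ∃₂ λ l m → m ≤ l × 2 ≤ m × l + m < n × G ≅ K⁻ n l m
    -- The first split puts the non-universal vertices on the left; the second divides these by
    -- nearness to `p`.
    K⁻-shaped with partition (λ v → not (does (universal? v)))
    ... | k , r , φ , sides with partition (λ i → does (near? p (Inverse.from φ (inj₁ i))))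
    ...   | l , m , ψ , sides′ = Classified.shape ((ψ ⊎-↔ ↔-id _) ↔-∘ φ) class
      where
      near-side : ∀ {v} → ¬ Universal v → (b : Fin l ⊎ Fin m) → left? b ≡ does (near? p v) →
                  Class {l} {m} {r} v (inj₁ b)
      near-side {v} ¬univ (inj₁ _) side = atP ¬univ (does-true⁻ (near? p v) (sym side))
      near-side {v} ¬univ (inj₂ _) side with near v
      ... | inj₁ nearp = contradiction nearp (does-false⁻ (near? p v) (sym side))
      ... | inj₂ nearq = atQ ¬univ nearq

      from-inj₁ : ∀ {v i} → Inverse.to φ v ≡ inj₁ i → Inverse.from φ (inj₁ i) ≡ v
      from-inj₁ {v} eq = trans (cong (Inverse.from φ) (sym eq)) (Inverse.strictlyInverseʳ φ v)

      side : ∀ {v} (b : Fin k ⊎ Fin r) → Inverse.to φ v ≡ b →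
             Class {l} {m} {r} v (Sum.map (Inverse.to ψ) (λ j → j) b)
      side {v} (inj₂ _) eq = top (decidable-stable (universal? v) (does-false⁻ (¬? (universal? v))
        (trans (sym (sides v)) (cong left? eq))))
      side {v} (inj₁ i) eq = near-side
        (does-true⁻ (¬? (universal? v)) (trans (sym (sides v)) (cong left? eq)))
        (Inverse.to ψ i)
        (trans (sides′ i) (cong (λ v → does (near? p v)) (from-inj₁ eq)))

      class : ∀ v → Class v (Inverse.to ((ψ ⊎-↔ ↔-id (Fin r)) ↔-∘ φ) v)
      class v = side (Inverse.to φ v) refl

  K⁻-shaped : Sharp (∃₂ λ l m → m ≤ l × 2 ≤ m × l + m < n × G ≅ K⁻ n l m)
  K⁻-shaped with fresh [] (≤-trans (s≤s z≤n) 5≤n)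
  -- The choice of `v` is arbitrary: only some nonadjacent pair is wanted.
  ... | v , _ with avoiding v v
  ...   | p , q , _ , _ , p≢q , ¬pq with common p≢q ¬pq
  ...     | c , pc , qc = sharp (Two.dim+3≤n p≢q ¬pq pc qc) (Two.K⁻-shaped p≢q ¬pq pc qc)

-- Lower bounds

module LowerBounds (G : Graph n) (conn : Connected G) where

  open Metric G conn

  ResolvedBy : Subset n → Set
  ResolvedBy W = ∀ u v → u Subset.∉ W → v Subset.∉ W → Adj G u v →
                 ∃ λ w → w Subset.∈ W × d u w ≢ d v w

  resolvedBy : ∀ {W} → IsLocalResolving G conn W → ResolvedBy W
  resolvedBy resolving u v u∉ v∉ uv = let w , w∈ , differs = resolving u v u∉ v∉ uv in
    w , w∈ , λ eq → differs (trans (sym (d≡dist u w)) (trans eq (d≡dist v w)))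

  -- True twins: adjacent vertices with the same closed neighbourhood.
  Twins : Fin n → Fin n → Set
  Twins u v = Adj G u v × (∀ w → w ≢ v → Adj G u w → Adj G v w) × (∀ w → w ≢ u → Adj G v w → Adj G u w)

  -- A geodesic from `u` to `w` either steps to `v` first or can be restarted from `v` at its second
  -- vertex; the argument is symmetric.
  twins-dist : ∀ {u v w} → Twins u v → w ≢ u → w ≢ v → d u w ≡ d v w
  twins-dist (_ , uv , vu) w≢u w≢v = ≤-antisym (half vu w≢v) (half uv w≢u)
    where
    half : ∀ {u v w} → (∀ x → x ≢ v → Adj G u x → Adj G v x) → w ≢ u → d v w ≤ d u w
    half {u} {v} {w} uv w≢u with d u w in eq
    ... | zero  = contradiction (sym (dist≡0⇒≡ eq)) w≢u
    ... | suc k with dist-pred eq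
    ...   | x , ux , refl with x ≟ v
    ...     | yes refl = n≤1+n _
    ...     | no x≢v   = dist-step (uv x x≢v ux)

  -- No third vertex separates twins, so a local resolving set omits at most one vertex of each
  -- class and `f` is injective on its complement.
  twinClasses⇒n≤k+dim : (f : Fin n → Fin k) → (∀ {u v} → u ≢ v → f u ≡ f v → Twins u v) →
                        n ≤ k + dimₗ G conn
  twinClasses⇒n≤k+dim {k} f twins = bound (proj₁ (proj₂ (localMetricDimension G conn)))
    where
    bound : ∀ {j} → HasLocalResolvingOfSize G conn j → n ≤ k + j
    bound (W , resolving , refl) = begin
      n               ≤⟨ m≤n+m∸n n ∣ W ∣ ⟩
      ∣ W ∣ + (n ∸ ∣ W ∣) ≡⟨ cong (∣ W ∣ +_) (∣∁p∣≡n∸∣p∣ W) ⟨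
      ∣ W ∣ + ∣ ∁ W ∣   ≤⟨ +-monoʳ-≤ ∣ W ∣ (injectiveOn⇒∣S∣≤ (∁ W) f injective) ⟩
      ∣ W ∣ + k       ≡⟨ +-comm ∣ W ∣ k ⟩
      k + ∣ W ∣       ∎
      where
      open ≤-Reasoning
      injective : ∀ {u v} → u Subset.∈ ∁ W → v Subset.∈ ∁ W → f u ≡ f v → u ≡ v
      injective {u} {v} u∈ v∈ eq = decidable-stable (u ≟ v) λ u≢v → absurd u≢v (twins u≢v eq)
        where
        absurd : u ≢ v → ¬ Twins u v
        absurd u≢v tw with resolvedBy resolving u v (x∈∁p⇒x∉p u∈) (x∈∁p⇒x∉p v∈) (proj₁ tw)
        ... | w , w∈ , differs = differs
          (twins-dist tw (λ { refl → x∈∁p⇒x∉p u∈ w∈ }) (λ { refl → x∈∁p⇒x∉p v∈ w∈ }))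

  -- Each of the three blocks consists of twins: whether an edge is deleted depends only on the
  -- blocks of its ends, and no edge inside a block is deleted.
  ≅K⁻⇒n∸3≤dim : G ≅ K⁻ n l m → n ∸ 3 ≤ dimₗ G conn
  ≅K⁻⇒n∸3≤dim {l} {m} iso = m≤n+o⇒m∸n≤o n 3 (twinClasses⇒n≤k+dim (block ∘ toℕ ∘ ψ) twins)
    where
    open _≅_ iso
    open Equivalence
    ψ = Inverse.to bijection

    block : ℕ → Fin 3
    block i with i <? l | i <? l + m
    ... | yes _ | _     = 0F
    ... | no _  | yes _ = 1F
    ... | no _  | no _  = 2F

    left : ∀ i j → block i ≡ block j → i < l → j < l
    left i j eq i<l with i <? l | i <? l + m | j <? l | j <? l + m
    ... | no i≮l | _ | _       | _ = contradiction i<l i≮l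
    ... | yes _  | _ | yes j<l | _ = j<l
    left i j () i<l | yes _ | _ | no _ | yes _
    left i j () i<l | yes _ | _ | no _ | no _

    right : ∀ i j → block i ≡ block j → l ≤ i × i < l + m → l ≤ j × j < l + m
    right i j eq (l≤i , i<l+m) with i <? l | i <? l + m | j <? l | j <? l + m
    ... | yes i<l | _         | _      | _         = contradiction l≤i (<⇒≱ i<l)
    ... | no _    | no i≮l+m  | _      | _         = contradiction i<l+m i≮l+m
    ... | no _    | yes _     | no j≮l | yes j<l+m = ≮⇒≥ j≮l , j<l+m
    right i j () _ | no _ | yes _ | yes _ | _
    right i j () _ | no _ | yes _ | no _  | no _

    transfer : ∀ {u v} → block (toℕ (ψ v)) ≡ block (toℕ (ψ u)) → ∀ w → w ≢ v → Adj G u w → Adj G v w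
    transfer {u} {v} eq w w≢v uw with to (adjacency u w) uw
    ... | _ , ¬deleted = from (adjacency v w)
      ( w≢v ∘ sym ∘ trans (sym (Inverse.strictlyInverseʳ bijection v)) ∘ (λ ψv≡ψw →
          trans (cong (Inverse.from bijection) ψv≡ψw) (Inverse.strictlyInverseʳ bijection w))
      , λ { (inj₁ (vl , wr)) → ¬deleted (inj₁ (left _ _ eq vl , wr))
          ; (inj₂ (wl , vr)) → ¬deleted (inj₂ (wl , right _ _ eq vr)) })

    twins : ∀ {u v} → u ≢ v → block (toℕ (ψ u)) ≡ block (toℕ (ψ v)) → Twins u v
    twins {u} {v} u≢v eq = from (adjacency u v)
      ( u≢v ∘ (λ ψu≡ψv → trans (sym (Inverse.strictlyInverseʳ bijection u))
          (trans (cong (Inverse.from bijection) ψu≡ψv) (Inverse.strictlyInverseʳ bijection v)))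
      , λ { (inj₁ (ul , vr)) → <⇒≱ ul (proj₁ (right _ _ (sym eq) vr))
          ; (inj₂ (vl , ur)) → <⇒≱ vl (proj₁ (right _ _ eq ur)) })
      , transfer (sym eq) , transfer eq

  dist≡2 : ∀ {u v w} → u ≢ w → ¬ Adj G u w → Adj G u v → Adj G v w → d u w ≡ 2
  dist≡2 {u} {v} {w} u≢w ¬uw uv vw with d u w in eq
    | ≤-trans (dist-step {v = w} uv) (s≤s (≤-reflexive (adj⇒dist≡1 vw)))
  ... | 0 | _ = contradiction (dist≡0⇒≡ eq) u≢w
  ... | 1 | _ = contradiction (dist≡1⇒adj eq) ¬uw
  ... | 2 | _ = refl
  ... | suc (suc (suc _)) | s≤s (s≤s ())

∈∧∈⇒2≤∣∣ : {S : Subset n} {u v : Fin n} → u Subset.∈ S → v Subset.∈ S → v ≢ u → 2 ≤ ∣ S ∣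
∈∧∈⇒2≤∣∣ u∈ v∈ v≢u = ≤-trans
  (s≤s (≤-trans (s≤s z≤n) (x∈p⇒∣p-x∣<∣p∣ (x∈p∧x≢y⇒x∈p-y v∈ v≢u)))) (x∈p⇒∣p-x∣<∣p∣ u∈)

-- An edge with both ends at distance two from `i`. Distance two is expressed by nonadjacency and a
-- common neighbour, so the property is decided by evaluation.
Opposite-edge : Fin 5 → Set
Opposite-edge i = ∃₂ λ u v → Adj C₅ u v × (u ≢ i × ¬ Adj C₅ u i) × (v ≢ i × ¬ Adj C₅ v i) ×
  (∃ λ a → Adj C₅ u a × Adj C₅ a i) × (∃ λ b → Adj C₅ v b × Adj C₅ b i)

opaque
  oppositeEdge : ∀ i → Opposite-edge i
  oppositeEdge = from-yes (all? λ i → any? λ u → any? λ v → adj? C₅ u v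
    ×-dec (¬? (u ≟ i) ×-dec ¬? (adj? C₅ u i)) ×-dec (¬? (v ≟ i) ×-dec ¬? (adj? C₅ v i))
    ×-dec (any? λ a → adj? C₅ u a ×-dec adj? C₅ a i) ×-dec (any? λ b → adj? C₅ v b ×-dec adj? C₅ b i))

module _ (G : Graph n) (conn : Connected G) (iso : G ≅ C₅) where

  open Metric G conn
  open LowerBounds G conn
  open _≅_ iso
  open Inverse bijection

  private
    adj⁺ : ∀ {i j} → Adj C₅ i j → Adj G (from i) (from j)
    adj⁺ {i} {j} a = Equivalence.from (adjacency (from i) (from j))
      (subst₂ (Adj C₅) (sym (strictlyInverseˡ i)) (sym (strictlyInverseˡ j)) a)

    adj⁻ : ∀ {i j} → Adj G (from i) (from j) → Adj C₅ i j
    adj⁻ {i} {j} a = subst₂ (Adj C₅) (strictlyInverseˡ i) (strictlyInverseˡ j)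
      (Equivalence.to (adjacency (from i) (from j)) a)

    from-injective : ∀ {i j} → from i ≡ from j → i ≡ j
    from-injective {i} {j} eq =
      trans (sym (strictlyInverseˡ i)) (trans (cong to eq) (strictlyInverseˡ j))

  oppositeEdge′ : ∀ w → ∃₂ λ u v → Adj G u v × u ≢ w × v ≢ w × d u w ≡ d v w
  oppositeEdge′ w with oppositeEdge (to w)
  ... | u , v , uv , (u≢ , ¬u) , (v≢ , ¬v) , (a , ua , ai) , (b , vb , bi) =
    subst (λ w → ∃₂ λ u v → Adj G u v × u ≢ w × v ≢ w × d u w ≡ d v w) (strictlyInverseʳ w)
      (from u , from v , adj⁺ uv , u≢ ∘ from-injective , v≢ ∘ from-injective ,
       trans (dist≡2 (u≢ ∘ from-injective) (¬u ∘ adj⁻) (adj⁺ ua) (adj⁺ ai))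
             (sym (dist≡2 (v≢ ∘ from-injective) (¬v ∘ adj⁻) (adj⁺ vb) (adj⁺ bi))))

  -- A vertex `w` of `W` does not separate the ends of its opposite edge, so `W` contains one of
  -- these ends or another vertex that separates them.
  resolvedBy⇒2≤ : ∀ {W} → ResolvedBy W → 2 ≤ ∣ W ∣
  resolvedBy⇒2≤ {W} resolve with nonempty
    where
    nonempty : ∃ λ w → w Subset.∈ W
    nonempty with from 0F Subset.∈? W | from 1F Subset.∈? W
    ... | yes ∈W | _      = _ , ∈W
    ... | _      | yes ∈W = _ , ∈W
    ... | no ∉W  | no ∉W′ with resolve _ _ ∉W ∉W′ (adj⁺ (inj₁ refl))
    ...   | w , w∈ , _ = w , w∈
  ... | w , w∈ with oppositeEdge′ w
  ...   | u , v , uv , u≢w , v≢w , eq with u Subset.∈? W | v Subset.∈? W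
  ...     | yes u∈ | _      = ∈∧∈⇒2≤∣∣ w∈ u∈ u≢w
  ...     | _      | yes v∈ = ∈∧∈⇒2≤∣∣ w∈ v∈ v≢w
  ...     | no u∉  | no v∉ with resolve u v u∉ v∉ uv
  ...       | w′ , w′∈ , differs = ∈∧∈⇒2≤∣∣ w∈ w′∈ λ { refl → differs eq }

  localResolving⇒2≤ : ∀ {k} → HasLocalResolvingOfSize G conn k → 2 ≤ k
  localResolving⇒2≤ (W , resolving , refl) = resolvedBy⇒2≤ (resolvedBy resolving)

  ≅C₅⇒n∸3≤dim : n ∸ 3 ≤ dimₗ G conn
  ≅C₅⇒n∸3≤dim = subst (λ n → n ∸ 3 ≤ dimₗ G conn) (sym (↔⇒≡ bijection))
    (localResolving⇒2≤ (proj₁ (proj₂ (localMetricDimension G conn))))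

-- The dichotomy and the theorem

Shape : Graph n → Set
Shape {n} G = G ≅ C₅ ⊎ (∃₂ λ (l m : ℕ) → m ≤ l × 2 ≤ m × l + m < n × G ≅ K⁻ n l m)

-- If the first bound fails, no spread set has four vertices. Then either some vertex with a
-- nonneighbour has two nonadjacent neighbours, which gives the pentagon, or `simplicial` holds,
-- which gives `K⁻`.
small-or-sharp : (G : Graph n) (conn : Connected G) → 5 ≤ n → Avoiding G →
                 dimₗ G conn + 4 ≤ n ⊎ (dimₗ G conn + 3 ≤ n × Shape G)
small-or-sharp {n} G conn 5≤n avoiding = go (dimₗ G conn + 4 ≤? n)
  where
  open Metric G conn using (Spread; spread⇒dim+length≤)
  go : Dec (dimₗ G conn + 4 ≤ n) → dimₗ G conn + 4 ≤ n ⊎ (dimₗ G conn + 3 ≤ n × Shape G)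
  go (yes small) = inj₁ small
  go (no ¬small) = inj₂ (frame? (any? λ x → any? λ y → any? λ a → any? λ b →
    ¬? (x ≟ y) ×-dec ¬? (adj? G x y) ×-dec ¬? (a ≟ b) ×-dec ¬? (adj? G a b) ×-dec
    adj? G x a ×-dec adj? G x b))
    where
    bad : ∀ U → Spread U → List.length U ≢ 4
    bad U spread len = ¬small (subst (λ k → dimₗ G conn + k ≤ n) len (spread⇒dim+length≤ spread))
    open Diameter2 G conn 5≤n avoiding bad
    Framed : Set
    Framed = ∃₂ λ x y → ∃₂ λ a b →
      x ≢ y × ¬ Adj G x y × a ≢ b × ¬ Adj G a b × Adj G x a × Adj G x b
    frame? : Dec Framed → dimₗ G conn + 3 ≤ n × Shape G
    frame? (yes (x , y , a , b , x≢y , ¬xy , a≢b , ¬ab , xa , xb)) =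
      Sharp.dim+3≤n p , inj₁ (Sharp.shape p)
      where p = Frame.pentagon x≢y ¬xy a≢b ¬ab xa xb
    frame? (no none) = Sharp.dim+3≤n p , inj₂ (Sharp.shape p)
      where p = Simplicial.K⁻-shaped G conn 5≤n avoiding bad λ x≢y ¬xy a≢b xa xb →
                  decidable-stable (adj? G _ _) λ ¬ab →
                    none (_ , _ , _ , _ , x≢y , ¬xy , a≢b , ¬ab , xa , xb)

-- In the first alternative `δ` is strictly below `n ∸ 3`, so both sides of the equivalence fail; in
-- the second both hold.
equality⇔ : ∀ {δ} {T : Set} → δ + 4 ≤ n ⊎ (δ + 3 ≤ n × T) → (T → n ∸ 3 ≤ δ) →
            δ ≤ n ∸ 3 × (δ ≡ n ∸ 3 ⇔ T)
equality⇔ {n} {δ} (inj₁ small) lower = <⇒≤ δ< , mk⇔ (λ eq → contradiction eq (<⇒≢ δ<))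
                                               (λ t → contradiction (lower t) (<⇒≱ δ<))
  where
  δ< : δ < n ∸ 3
  δ< = m+n≤o⇒m≤o∸n (suc δ) (subst (_≤ n) (+-suc δ 3) small)
equality⇔ (inj₂ (sharp , t)) lower = δ≤ , mk⇔ (λ _ → t) (λ t → ≤-antisym δ≤ (lower t))
  where δ≤ = m+n≤o⇒m≤o∸n _ sharp

theorem2p2 : ∀ {n : ℕ} (G : Graph n) (conn : Connected G) →
    5 ≤ n → ω G ≤ n ∸ 3 →
    dimₗ G conn ≤ n ∸ 3 ×
    (dimₗ G conn ≡ n ∸ 3 ⇔
    (G ≅ C₅ ⊎ (∃₂ λ (l m : ℕ) → m ≤ l × 2 ≤ m × l + m < n × G ≅ K⁻ n l m)))
theorem2p2 G conn 5≤n ω≤ = equality⇔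
  (small-or-sharp G conn 5≤n (ω≤n∸3⇒avoiding G 5≤n ω≤))
  [ ≅C₅⇒n∸3≤dim G conn , (λ (l , m , _ , _ , _ , iso) → LowerBounds.≅K⁻⇒n∸3≤dim G conn iso) ]′
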